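{- Let $t$ be a positive integer. There is a bijection $\psi_t:\lambda\mapsto\mu$ from the set of $t$-core partitions onto the set of all partitions $\mu$ of length at most $t-1$ such that $\{\mu_i-i \bmod t: i=1,\ldots,t\}=\{0,1,\ldots,t-1\}$, such that for every $t$-core $\lambda$, with $\mu=\psi_t(\lambda)$, $$|\lambda|=-|\mu|\,\frac{|\mu|+t+t^2}{2t^2}+\sum_{i=1}^{t}\frac{\mu_i^2+2(t+1-i)\mu_i}{2t},$$ and moreover, for any function $\tau$ from $\mathbb{Z}$ to a field $F$ for which all the denominators below are nonzero (i.e. $\tau$ does not vanish at the hook lengths of $\lambda$, at the hook lengths of $\mu$, or at $1,\ldots,t-1$), $$\prod_{\square\in\lambda}\frac{\tau(h_\square-t)\,\tau(h_\square+t)}{\tau(h_\square)^2}=\prod_{i=1}^{t-1}\left(\frac{\tau(-i)}{\tau(i)}\right)^{\beta_i(\lambda)}\prod_{\square\in\mu}\frac{\tau(t+c_\square)}{\tau(h_\square)},$$ where $\beta_i(\lambda)=\#\{\square\in\lambda:h_\square=t-i\}$.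
   Context: Partitions are integer partitions $\mu=(\mu_1\ge\mu_2\ge\cdots)$ (including the empty one), with $\mu_i=0$ for $i$ larger than the length of $\mu$; $|\mu|$ is the size. For a box $\square$ of the Ferrers diagram of a partition, $h_\square$ is its hook length in that partition, and $c_\square=j-i$ is its content if $\square$ lies in row $i$ and column $j$. A partition is a $t$-core if none of its hook lengths is divisible by $t$. -}

module Defs where

open import Level using (Level; Setω)
open import Algebra.Apartness.Bundles using (HeytingField)
open import Algebra.Bundles using (CommutativeRing)
open import Data.Integer.Base as ℤ using (ℤ; +_)
open import Data.List.Base using (List; []; _∷_; applyUpTo; concatMap; drop; filter; foldr; length; map; upTo)
open import Data.List.Relation.Binary.BagAndSetEquality using (_∼[_]_; set)
open import Data.List.Relation.Unary.All using (All; reduce)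
open import Data.List.Relation.Unary.Linked using (Linked)
open import Data.Nat.Base using (ℕ; zero; suc; pred; _+_; _∸_; _≤_; _<_; _≥_; NonZero)
open import Data.Nat.Divisibility using (_∤_)
open import Data.Nat.ListAction using (sum)
open import Data.Nat.Properties using (_≤?_; _≟_)
open import Data.Product.Base using (_×_; _,_; proj₁)
open import Data.Rational.Base as ℚ using (ℚ; 0ℚ)
open import Data.Refinement.Base using (Refinement-syntax)

-- Quantifying over fields of all universe levels gives a proposition in Setω,
-- out of reach of Σ and _×_.

record Σω {a : Level} (A : Set a) (B : A → Setω) : Setω where
  constructor _,ω_
  field
    fst : A
    snd : B fst

infixr 2 _×ω_

_×ω_ : ∀ {a : Level} → Set a → Setω → Setω
A ×ω B = Σω A λ _ → B

[1…_] : ℕ → List ℕ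
[1… n ] = applyUpTo suc n

-- The two conditions are irrelevant fields, so partitions with the same parts
-- are propositionally equal.

record Partition : Set where
  constructor mkPartition
  field
    parts       : List ℕ
    .decreasing : Linked _≥_ parts
    .positive   : All (0 <_) parts

open Partition public

nth : List ℕ → ℕ → ℕ
nth []       _       = 0
nth (x ∷ _)  zero    = x
nth (_ ∷ xs) (suc n) = nth xs n

-- Rows and columns are numbered from 1; `part μ 0` is never used.

part : Partition → ℕ → ℕ
part μ i = nth (parts μ) (pred i)

len : Partition → ℕ
len μ = length (parts μ)

size : Partition → ℕ
size μ = sum (parts μ)

-- (row , column)

Box : Set
Box = ℕ × ℕ

boxes : Partition → List Box
boxes μ = concatMap (λ i → map (i ,_) [1… part μ i ]) [1… len μ ]

arm : Partition → Box → ℕ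
arm μ (i , j) = part μ i ∸ j

-- The number of rows strictly below row i that reach column j.

leg : Partition → Box → ℕ
leg μ (i , j) = length (filter (j ≤?_) (drop i (parts μ)))

hook : Partition → Box → ℕ
hook μ □ = suc (arm μ □ + leg μ □)

content : Box → ℤ
content (i , j) = + j ℤ.- + i

IsCore : ℕ → Partition → Set
IsCore t μ = All (λ □ → t ∤ hook μ □) (boxes μ)

-- `Refinement` has an irrelevant proof component, so equality of cores is
-- equality of the underlying partitions.

Core : ℕ → Set
Core t = [ μ ∈ Partition ∣ IsCore t μ ]

-- `_%ℕ_` takes its values in {0, …, t - 1}, also at negative integers.

CompleteResidues : (t : ℕ) .{{_ : NonZero t}} → Partition → Set
CompleteResidues t μ =
  map (λ i → (+ part μ i ℤ.- + i) ℤ.%ℕ t) [1… t ] ∼[ set ] upTo t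

CompletePartition : (t : ℕ) .{{_ : NonZero t}} → Set
CompletePartition t = [ μ ∈ Partition ∣ len μ ≤ t ∸ 1 × CompleteResidues t μ ]

-- For 1 ≤ i ≤ t - 1.

β : (t : ℕ) → ℕ → Partition → ℕ
β t i μ = length (filter (λ □ → hook μ □ ≟ t ∸ i) (boxes μ))

∑ : List ℕ → (ℕ → ℚ) → ℚ
∑ is f = foldr ℚ._+_ 0ℚ (map f is)

module FieldOps {c ℓ₁ ℓ₂ : Level} (F : HeytingField c ℓ₁ ℓ₂) where

  open HeytingField F public
    using (Carrier; _≈_; _#_; 0#; 1#; _*_; #⇒invertible; heytingCommutativeRing)
  open import Algebra.Apartness.Bundles using (HeytingCommutativeRing)
  open HeytingCommutativeRing heytingCommutativeRing using (commutativeRing)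
  open CommutativeRing commutativeRing using (semiring)
  open import Algebra.Properties.Semiring.Exp semiring public using (_^_)
  open import Algebra.Apartness.Properties.HeytingCommutativeRing heytingCommutativeRing
    using (1#0; x#0y#0→xy#0)

  infixl 7 _÷_⟨_⟩

  -- The library's inverse obtained from y # 0# is that of y - 0#.

  _÷_⟨_⟩ : Carrier → (y : Carrier) → y # 0# → Carrier
  x ÷ y ⟨ y#0 ⟩ = x * proj₁ (#⇒invertible y#0)

  ^-#0 : ∀ {x} → x # 0# → ∀ n → x ^ n # 0#
  ^-#0 x#0 zero    = 1#0
  ^-#0 x#0 (suc n) = x#0y#0→xy#0 x#0 (^-#0 x#0 n)

  -- The product over x in xs of f x p, where p is the given proof of P x; this
  -- is how factors that are quotients receive their nonvanishing denominators.

  ∏ : ∀ {a p : Level} {A : Set a} {P : A → Set p} {xs : List A} →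
      All P xs → (∀ x → P x → Carrier) → Carrier
  ∏ pxs f = foldr _*_ 1# (reduce (λ {x} → f x) pxs)

{-# OPTIONS --safe #-}
-- Encode a partition by its first-column hooks x₁ > … > x_N, x_i = λ_i + N - i.
-- The hooks of row i and the differences x_i - x_j (j > i) together make up
-- {1, …, x_i}. Let S be the set of the x_i together with all negative integers. A
-- hook of length k is a pair (x , x - k) with x ∈ S and x - k ∉ S, and λ is a
-- t-core iff S - t ⊆ S. In that case V = (S + t) ∖ S has one element in each
-- residue class, its least element is 0, and it determines S; subtracting
-- t - 1, …, 1, 0 from its elements in decreasing order gives μ. For h(k) the
-- number of hooks of length k, h(k + t) - 2 h(k) + h(k - t) telescopes to the
-- number of pairs in V with difference k, and the row identity for V turns these
-- differences into contents and hooks of μ. This gives the multiset identity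
--   {h + t} ∪ {|h - t|} ∪ hooks(μ) = {t + c} ∪ 2 hooks(λ),
-- in which τ yields the product formula and squaring the size formula.

module Submission where

-- S is infinite, but a shift by `t` brings only the integers from - t on to natural numbers. Moved
-- up by `t`, S becomes a 0-1 function on ℕ that is 1 on the first `t` places and 0 from some place
-- on. Multisets are compared by multiplicities, which are finite sums of products of such
-- functions, and identities carry positive terms on both sides in place of differences.
--
-- The telescoping has an end effect. At lengths k < t it needs h at the negative argument k - t = -
-- j, where its value is h(j) + j. The excess j = t - k is the multiplicity of k among the
-- differences of {0, ..., t - 1}. These differences occur again in the row identity for V: hooks of
-- μ together with differences of V equal shifted contents together with differences of {0, ..., t -
-- 1}. On adding the two identities the differences of V and the excess cancel, so the result has no
-- error term.
--
-- V yields `t` rows, and as 0 is in V at least one of them is zero. Dropping the zero rows leaves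
-- at most t - 1 parts, and padding to `t` rows recovers them.

module Combinatorics where

  open import Algebra.Bundles using (CommutativeMonoid)
  open import Data.Empty using (⊥-elim)
  open import Data.Integer.Base as ℤ using (ℤ; -[1+_])
  import Data.Integer.Properties as ℤP
  import Data.Integer.Solver as ℤS
  open import Data.Irrelevant using ([_])
  open import Data.List.Base using (List; []; _∷_; _++_; length; map; applyUpTo; concat; concatMap; drop; downFrom; filter; upTo; replicate)
  open import Data.List.Membership.Propositional using (_∈_; _∉_; find; lose)
  open import Data.List.Membership.Propositional.Properties using (∈-∃++; ∈-filter⁺; ∈-filter⁻; ∈-downFrom⁺; ∈-map⁺; ∈-map⁻; ∈-upTo⁺; ∈-upTo⁻)
  open import Data.List.Properties using (applyUpTo-∷ʳ; map-applyUpTo; map-∘; map-++; ++-identityʳ; filter-none; concat-map; length-applyUpTo; filter-accept; filter-reject; map-cong-local; length-map; length-++; length-replicate; length-downFrom)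
  open import Data.List.Relation.Binary.Permutation.Propositional as Perm using (_↭_; ↭-refl; ↭-sym; ↭-trans; ↭-reflexive; prep; swap; module PermutationReasoning)
  open import Data.List.Relation.Binary.Permutation.Propositional.Properties using (shift; ++⁺; ++⁺ʳ; ++-comm; map⁺; ∷↭∷ʳ; ↭-length; ++-commutativeMonoid)
  open import Data.List.Relation.Unary.All as All using (All; []; _∷_)
  import Data.List.Relation.Unary.All.Properties as AllP
  open import Data.List.Relation.Unary.AllPairs using (AllPairs; []; _∷_)
  import Data.List.Relation.Unary.AllPairs.Properties as AllPairsP
  open import Data.List.Relation.Unary.Any as Any using (Any; any?; here; there)
  open import Data.List.Relation.Unary.Linked using (linked?)
  open import Data.List.Relation.Unary.Linked.Properties using (Linked⇒AllPairs; AllPairs⇒Linked)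
  open import Data.Nat.Base using (ℕ; zero; suc; pred; _+_; _*_; _∸_; _≤_; _<_; _≥_; _>_; z≤n; s≤s; NonZero; ∣_-_∣; >-nonZero⁻¹; _^_)
  open import Data.Nat.DivMod using (_%_; _/_; [m+n]%n≡m%n; m≡m%n+[m/n]*n; m<n⇒m%n≡m; m%n<n; n%n≡0)
  open import Data.Nat.Divisibility using (_∣_; _∤_; _∣?_; divides; ∣m∣n⇒∣m+n; ∣-refl)
  open import Data.Nat.ListAction using (sum)
  open import Data.Nat.ListAction.Properties using (sum-++; sum-↭)
  open import Data.Nat.Properties
  open import Data.List.Membership.DecPropositional _≟_ using (_∈?_)
  open import Data.Nat.Solver using (module +-*-Solver)
  open import Data.Product.Base using (_×_; _,_; proj₁; proj₂; ∃)
  open import Data.Rational.Base as ℚ using (ℚ)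
  import Data.Rational.Properties as ℚP
  open import Data.Rational.Unnormalised.Base as ℚᵘ using (mkℚᵘ; *≡*)
  import Data.Rational.Unnormalised.Properties as ℚᵘP
  open import Data.Refinement.Base using (Refinement; value; _,_)
  open import Data.Sum.Base using (_⊎_; inj₁; inj₂)
  open import Defs
  open import Function.Base using (_∘_; id)
  open import Function.Bundles using (_⤖_; mk⤖; mk⇔; module Equivalence)
  open import Relation.Binary.PropositionalEquality using (_≡_; _≢_; refl; sym; trans; cong; cong₂; subst; module ≡-Reasoning)
  open import Relation.Nullary using (¬_; yes; no; recompute)
  open import Relation.Nullary.Decidable using (_×-dec_; ¬?; decidable-stable)
  open import Relation.Unary using (Pred; Decidable)

  -- Finite sums and counting

  Σ< : ℕ → (ℕ → ℕ) → ℕ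
  Σ< zero    f = 0
  Σ< (suc n) f = f 0 + Σ< n (f ∘ suc)

  Σ<-cong : ∀ n {f g : ℕ → ℕ} → (∀ x → f x ≡ g x) → Σ< n f ≡ Σ< n g
  Σ<-cong zero    f≗g = refl
  Σ<-cong (suc n) f≗g = cong₂ _+_ (f≗g 0) (Σ<-cong n (f≗g ∘ suc))

  Σ<-+ : ∀ n (f g : ℕ → ℕ) → Σ< n (λ x → f x + g x) ≡ Σ< n f + Σ< n g
  Σ<-+ zero    f g = refl
  Σ<-+ (suc n) f g = begin
    f 0 + g 0 + Σ< n (λ x → f (suc x) + g (suc x))      ≡⟨ cong (f 0 + g 0 +_) (Σ<-+ n _ _) ⟩
    f 0 + g 0 + (Σ< n (f ∘ suc) + Σ< n (g ∘ suc))       ≡⟨ +-interchange (f 0) (g 0) _ _ ⟩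
    f 0 + Σ< n (f ∘ suc) + (g 0 + Σ< n (g ∘ suc))       ∎
    where
    open ≡-Reasoning
    open import Algebra.Properties.CommutativeSemigroup +-commutativeSemigroup using () renaming (interchange to +-interchange)

  Σ<-split : ∀ m n (f : ℕ → ℕ) → Σ< (m + n) f ≡ Σ< m f + Σ< n (f ∘ (m +_))
  Σ<-split zero    n f = refl
  Σ<-split (suc m) n f = trans (cong (f 0 +_) (Σ<-split m n (f ∘ suc))) (sym (+-assoc (f 0) _ _))

  Σ<-const : ∀ n c {f : ℕ → ℕ} → (∀ {x} → x < n → f x ≡ c) → Σ< n f ≡ n * c
  Σ<-const zero    c f≡c = refl
  Σ<-const (suc n) c f≡c = cong₂ _+_ (f≡c (s≤s z≤n)) (Σ<-const n c (f≡c ∘ s≤s))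

  Σ<-zero : ∀ n {f : ℕ → ℕ} → (∀ {x} → x < n → f x ≡ 0) → Σ< n f ≡ 0
  Σ<-zero n f≡0 = trans (Σ<-const n 0 f≡0) (*-zeroʳ n)

  Σ<-zero⁻¹ : ∀ n (f : ℕ → ℕ) → Σ< n f ≡ 0 → ∀ {x} → x < n → f x ≡ 0
  Σ<-zero⁻¹ (suc n) f Σ≡0 {zero}  _         = m+n≡0⇒m≡0 (f 0) Σ≡0
  Σ<-zero⁻¹ (suc n) f Σ≡0 {suc x} (s≤s x<n) = Σ<-zero⁻¹ n (f ∘ suc) (m+n≡0⇒n≡0 (f 0) Σ≡0) x<n

  -- Both windows have length `M`: the `s` places that enter at the top contribute nothing. Sliding
  -- a fixed window imitates reindexing a sum over all integers.
  Σ<-shift : ∀ s M (f : ℕ → ℕ) → (∀ {x} → M ≤ x → f x ≡ 0) →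
             Σ< M f ≡ Σ< s f + Σ< M (f ∘ (s +_))
  Σ<-shift s M f f≡0 = begin
    Σ< M f                        ≡⟨ +-identityʳ _ ⟨
    Σ< M f + 0                    ≡⟨ cong (Σ< M f +_) (Σ<-zero s (λ _ → f≡0 (m≤m+n M _))) ⟨
    Σ< M f + Σ< s (f ∘ (M +_))    ≡⟨ Σ<-split M s f ⟨
    Σ< (M + s) f                  ≡⟨ cong (λ n → Σ< n f) (+-comm M s) ⟩
    Σ< (s + M) f                  ≡⟨ Σ<-split s M f ⟩
    Σ< s f + Σ< M (f ∘ (s +_))    ∎
    where open ≡-Reasoning

  Σ<-shift₀ : ∀ s M (f : ℕ → ℕ) → (∀ {x} → x < s → f x ≡ 0) → (∀ {x} → M ≤ x → f x ≡ 0) →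
              Σ< M f ≡ Σ< M (f ∘ (s +_))
  Σ<-shift₀ s M f f≡0 f≡0′ = trans (Σ<-shift s M f f≡0′) (cong (_+ Σ< M (f ∘ (s +_))) (Σ<-zero s f≡0))

  -- Recursion instead of a decision makes `δ (suc x) (suc y)` reduce to `δ x y`, so sums over
  -- shifted arguments can be handled by plain induction.
  δ : ℕ → ℕ → ℕ
  δ zero    zero    = 1
  δ zero    (suc y) = 0
  δ (suc x) zero    = 0
  δ (suc x) (suc y) = δ x y

  δ-refl : ∀ x → δ x x ≡ 1
  δ-refl zero    = refl
  δ-refl (suc x) = δ-refl x

  δ-≢ : ∀ {x y} → x ≢ y → δ x y ≡ 0
  δ-≢ {zero}  {zero}  x≢y = ⊥-elim (x≢y refl)
  δ-≢ {zero}  {suc y} x≢y = refl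
  δ-≢ {suc x} {zero}  x≢y = refl
  δ-≢ {suc x} {suc y} x≢y = δ-≢ (x≢y ∘ cong suc)

  Σ<-δ : ∀ {M x} → x < M → Σ< M (λ y → δ y x) ≡ 1
  Σ<-δ {suc M} {zero}  _         = cong suc (Σ<-zero M (λ _ → refl))
  Σ<-δ {suc M} {suc x} (s≤s x<M) = Σ<-δ x<M

  count : ℕ → List ℕ → ℕ
  count k []       = 0
  count k (x ∷ xs) = δ k x + count k xs

  count-++ : ∀ k xs ys → count k (xs ++ ys) ≡ count k xs + count k ys
  count-++ k []       ys = refl
  count-++ k (x ∷ xs) ys = trans (cong (δ k x +_) (count-++ k xs ys)) (sym (+-assoc (δ k x) _ _))

  count-↭ : ∀ k {xs ys} → xs ↭ ys → count k xs ≡ count k ys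
  count-↭ k Perm.refl                     = refl
  count-↭ k (prep x xs↭ys)                = cong (δ k x +_) (count-↭ k xs↭ys)
  count-↭ k (Perm.trans p q)              = trans (count-↭ k p) (count-↭ k q)
  count-↭ k (swap {xs} {ys} x y xs↭ys)    = begin
    δ k x + (δ k y + count k xs)   ≡⟨ +-assoc (δ k x) _ _ ⟨
    δ k x + δ k y + count k xs     ≡⟨ cong₂ _+_ (+-comm (δ k x) _) (count-↭ k xs↭ys) ⟩
    δ k y + δ k x + count k ys     ≡⟨ +-assoc (δ k y) _ _ ⟩
    δ k y + (δ k x + count k ys)   ∎
    where open ≡-Reasoning

  ∈⇒count : ∀ {k xs} → k ∈ xs → count k xs ≢ 0
  ∈⇒count {k} {_ ∷ xs} (here refl) eq with () ← trans (sym (cong (_+ count k xs) (δ-refl k))) eq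
  ∈⇒count {k} {x ∷ xs} (there k∈xs) eq = ∈⇒count k∈xs (m+n≡0⇒n≡0 (δ k x) eq)

  count⇒∈ : ∀ {k} xs → count k xs ≢ 0 → k ∈ xs
  count⇒∈ []           c≢0 = ⊥-elim (c≢0 refl)
  count⇒∈ {k} (x ∷ xs) c≢0 with k ≟ x
  ... | yes k≡x = here k≡x
  ... | no  k≢x = there (count⇒∈ xs λ c≡0 → c≢0 (cong₂ _+_ (δ-≢ k≢x) c≡0))

  count-∉ : ∀ {k} xs → k ∉ xs → count k xs ≡ 0
  count-∉ {k} xs k∉xs with count k xs ≟ 0
  ... | yes c≡0 = c≡0
  ... | no  c≢0 = ⊥-elim (k∉xs (count⇒∈ xs c≢0))

  count⇒↭ : ∀ xs ys → (∀ k → count k xs ≡ count k ys) → xs ↭ ys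
  count⇒↭ []       []       eq = ↭-refl
  count⇒↭ []       (y ∷ ys) eq = ⊥-elim (∈⇒count {y} {y ∷ ys} (here refl) (sym (eq y)))
  count⇒↭ (x ∷ xs) ys       eq with ∈-∃++ (count⇒∈ ys (∈⇒count {x} {x ∷ xs} (here refl) ∘ trans (eq x)))
  ... | as , bs , refl = ↭-trans (prep x (count⇒↭ xs (as ++ bs) eq′)) (↭-sym (shift x as bs))
    where
    eq′ : ∀ k → count k xs ≡ count k (as ++ bs)
    eq′ k = +-cancelˡ-≡ (δ k x) _ _ (trans (eq k) (count-↭ k (shift x as bs)))

  applyUpTo-cong : ∀ {a} {A : Set a} {f g : ℕ → A} n → (∀ {i} → i < n → f i ≡ g i) → applyUpTo f n ≡ applyUpTo g n
  applyUpTo-cong zero    eq = refl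
  applyUpTo-cong (suc n) eq = cong₂ _∷_ (eq (s≤s z≤n)) (applyUpTo-cong n (eq ∘ s≤s))

  applyUpTo-++ : ∀ {a} {A : Set a} (f : ℕ → A) m n → applyUpTo f (m + n) ≡ applyUpTo f m ++ applyUpTo (f ∘ (m +_)) n
  applyUpTo-++ f zero    n = refl
  applyUpTo-++ f (suc m) n = cong (f 0 ∷_) (applyUpTo-++ (f ∘ suc) m n)

  [1…+] : ∀ m n → [1… m + n ] ≡ [1… m ] ++ map (m +_) [1… n ]
  [1…+] m n = trans (applyUpTo-++ suc m n) (cong ([1… m ] ++_)
    (trans (applyUpTo-cong n (λ {i} _ → sym (+-suc m i))) (sym (map-applyUpTo suc (m +_) n))))

  -- Finite sets as strictly decreasing lists

  StrictlyDecreasing : List ℕ → Set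
  StrictlyDecreasing = AllPairs _>_

  WeaklyDecreasing : List ℕ → Set
  WeaklyDecreasing = AllPairs _≥_

  ⊆⇒<⊎≡ : ∀ {xs} ys → StrictlyDecreasing xs → StrictlyDecreasing ys → (∀ {z} → z ∈ xs → z ∈ ys) →
          length xs < length ys ⊎ xs ≡ ys
  ⊆⇒<⊎≡ {[]}     []       _ _ _  = inj₂ refl
  ⊆⇒<⊎≡ {x ∷ xs} []       _ _ ⊆ with () ← ⊆ (here refl)
  ⊆⇒<⊎≡ {[]}     (y ∷ ys) _ _ _  = inj₁ (s≤s z≤n)
  ⊆⇒<⊎≡ {x ∷ xs} (y ∷ ys) (x> ∷ sxs) (y> ∷ sys) ⊆ with ⊆ (here refl)
  ... | here refl = lift (⊆⇒<⊎≡ ys sxs sys tail)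
    where
    tail : ∀ {z} → z ∈ xs → z ∈ ys
    tail z∈xs with ⊆ (there z∈xs)
    ... | here refl  = ⊥-elim (<-irrefl refl (All.lookup x> z∈xs))
    ... | there z∈ys = z∈ys
    lift : length xs < length ys ⊎ xs ≡ ys → _
    lift (inj₁ lt)   = inj₁ (s≤s lt)
    lift (inj₂ refl) = inj₂ refl
  ... | there x∈ys = lift (⊆⇒<⊎≡ ys (x> ∷ sxs) sys tail)
    where
    tail : ∀ {z} → z ∈ x ∷ xs → z ∈ ys
    tail (here refl)  = x∈ys
    tail (there z∈xs) with ⊆ (there z∈xs)
    ... | here refl  = ⊥-elim (<-asym (All.lookup x> z∈xs) (All.lookup y> x∈ys))
    ... | there z∈ys = z∈ys
    lift : length (x ∷ xs) < length ys ⊎ x ∷ xs ≡ ys → _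
    lift (inj₁ lt)   = inj₁ (m<n⇒m<1+n lt)
    lift (inj₂ refl) = inj₁ ≤-refl

  ⊆-length⇒≡ : ∀ {xs ys} → StrictlyDecreasing xs → StrictlyDecreasing ys → (∀ {z} → z ∈ xs → z ∈ ys) →
               length xs ≡ length ys → xs ≡ ys
  ⊆-length⇒≡ {xs} {ys} sxs sys ⊆ len≡ with ⊆⇒<⊎≡ ys sxs sys ⊆
  ... | inj₁ lt = ⊥-elim (<-irrefl len≡ lt)
  ... | inj₂ eq = eq

  count-injective : ∀ {xs ys} → StrictlyDecreasing xs → StrictlyDecreasing ys →
                    (∀ k → count k xs ≡ count k ys) → xs ≡ ys
  count-injective {xs} {ys} sxs sys eq = ⊆-length⇒≡ sxs sys
    (λ {z} z∈xs → count⇒∈ ys (∈⇒count z∈xs ∘ trans (eq z)))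
    (↭-length (count⇒↭ xs ys eq))

  count-≤1 : ∀ {k xs} → StrictlyDecreasing xs → count k xs ≤ 1
  count-≤1 {k} {[]}     _           = z≤n
  count-≤1 {k} {x ∷ xs} (x> ∷ sxs) with k ≟ x
  ... | yes refl = ≤-reflexive (cong₂ _+_ (δ-refl k) (count-∉ xs λ k∈xs → <-irrefl refl (All.lookup x> k∈xs)))
  ... | no  k≢x  = subst (λ d → d + count k xs ≤ 1) (sym (δ-≢ k≢x)) (count-≤1 sxs)

  Σ<-count : ∀ {M xs} → All (_< M) xs → Σ< M (λ x → count x xs) ≡ length xs
  Σ<-count {M} []               = Σ<-zero M (λ _ → refl)
  Σ<-count {M} {x ∷ xs} (x<M ∷ xs<M) = trans (Σ<-+ M (λ y → δ y x) _) (cong₂ _+_ (Σ<-δ x<M) (Σ<-count xs<M))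

  ∉-≥bound : ∀ {M k xs} → All (_< M) xs → M ≤ k → k ∉ xs
  ∉-≥bound xs<M M≤k k∈xs = <-irrefl refl (<-≤-trans (All.lookup xs<M k∈xs) M≤k)

  -- Differences and initial intervals

  Δ : List ℕ → List ℕ
  Δ []       = []
  Δ (x ∷ xs) = map (x ∸_) xs ++ Δ xs

  intervals : List ℕ → List ℕ
  intervals = concatMap [1…_]

  𝟙≤ : ℕ → ℕ → ℕ
  𝟙≤ zero    n       = 1
  𝟙≤ (suc k) zero    = 0
  𝟙≤ (suc k) (suc n) = 𝟙≤ k n

  count-map-suc : ∀ k xs → count (suc k) (map suc xs) ≡ count k xs
  count-map-suc k []       = refl
  count-map-suc k (x ∷ xs) = cong (δ k x +_) (count-map-suc k xs)

  count-map-suc₀ : ∀ xs → count 0 (map suc xs) ≡ 0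
  count-map-suc₀ []       = refl
  count-map-suc₀ (x ∷ xs) = count-map-suc₀ xs

  count-[1…] : ∀ k n → count (suc k) [1… n ] ≡ 𝟙≤ (suc k) n
  count-[1…] k zero    = refl
  count-[1…] zero (suc n) = cong suc (trans (cong (count 1) (sym (map-applyUpTo suc suc n)))
    (trans (count-map-suc 0 [1… n ]) (trans (cong (count 0) (sym (map-applyUpTo id suc n))) (count-map-suc₀ (upTo n)))))
  count-[1…] (suc k) (suc n) = trans (cong (count (2 + k)) (sym (map-applyUpTo suc suc n)))
    (trans (count-map-suc (suc k) [1… n ]) (count-[1…] k n))

  Σ<-δ-+ : ∀ {M n} k → n < M → Σ< M (λ y → δ (k + y) n) ≡ 𝟙≤ k n
  Σ<-δ-+ zero    n<M = Σ<-δ n<M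
  Σ<-δ-+ {M} {zero}  (suc k) n<M = Σ<-zero M (λ _ → refl)
  Σ<-δ-+ {M} {suc n} (suc k) n<M = Σ<-δ-+ k (<-trans (n<1+n n) n<M)

  -- `suc k` lies in {1, ..., x} exactly when x = suc k + y for some natural y, which is then
  -- unique. Counting by this `y` gives the same shape as `count-Δ`, so the two can be compared term
  -- by term.
  count-intervals : ∀ {M xs} k → All (_< M) xs → count (suc k) (intervals xs) ≡ Σ< M (λ y → count (suc k + y) xs)
  count-intervals {M} k []   = sym (Σ<-zero M (λ _ → refl))
  count-intervals {M} {x ∷ xs} k (x<M ∷ xs<M) = begin
    count (suc k) ([1… x ] ++ intervals xs)                                       ≡⟨ count-++ (suc k) [1… x ] _ ⟩
    count (suc k) [1… x ] + count (suc k) (intervals xs)                          ≡⟨ cong₂ _+_ (trans (count-[1…] k x) (sym (Σ<-δ-+ (suc k) x<M))) (count-intervals k xs<M) ⟩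
    Σ< M (λ y → δ (suc k + y) x) + Σ< M (λ y → count (suc k + y) xs)              ≡⟨ Σ<-+ M (λ y → δ (suc k + y) x) _ ⟨
    Σ< M (λ y → δ (suc k + y) x + count (suc k + y) xs)                           ∎
    where open ≡-Reasoning

  count-map-∸ : ∀ {x} k xs → All (_< x) xs → count k (map (x ∸_) xs) ≡ Σ< x (λ y → δ (k + y) x * count y xs)
  count-map-∸ {x} k []       []   = sym (Σ<-zero x (λ {y} _ → *-zeroʳ (δ (k + y) x)))
  count-map-∸ {x} k (z ∷ zs) (z<x ∷ zs<x) = begin
    δ k (x ∸ z) + count k (map (x ∸_) zs)                                              ≡⟨ cong₂ _+_ (pick z<x) (count-map-∸ k zs zs<x) ⟩
    Σ< x (λ y → δ (k + y) x * δ y z) + Σ< x (λ y → δ (k + y) x * count y zs)            ≡⟨ Σ<-+ x (λ y → δ (k + y) x * δ y z) _ ⟨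
    Σ< x (λ y → δ (k + y) x * δ y z + δ (k + y) x * count y zs)                        ≡⟨ Σ<-cong x (λ y → *-distribˡ-+ (δ (k + y) x) (δ y z) _) ⟨
    Σ< x (λ y → δ (k + y) x * (δ y z + count y zs))                                    ∎
    where
    open ≡-Reasoning
    δ-∸ : ∀ x {z} → z ≤ x → δ k (x ∸ z) ≡ δ (k + z) x
    δ-∸ x       {zero}  z≤x = cong (λ j → δ j x) (sym (+-identityʳ k))
    δ-∸ (suc x) {suc z} (s≤s z≤x) = trans (δ-∸ x z≤x) (cong (λ j → δ j (suc x)) (sym (+-suc k z)))
    Σ<-pick : ∀ M {z} (f : ℕ → ℕ) → z < M → Σ< M (λ y → f y * δ y z) ≡ f z
    Σ<-pick (suc M) {zero}  f z<M = trans (cong₂ _+_ (*-identityʳ (f 0)) (Σ<-zero M (λ {y} _ → *-zeroʳ (f (suc y))))) (+-identityʳ (f 0))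
    Σ<-pick (suc M) {suc z} f (s≤s z<M) = trans (cong (_+ Σ< M (λ y → f (suc y) * δ y z)) (*-zeroʳ (f 0))) (Σ<-pick M (f ∘ suc) z<M)
    pick : ∀ {z} → z < x → δ k (x ∸ z) ≡ Σ< x (λ y → δ (k + y) x * δ y z)
    pick z<x = trans (δ-∸ x (<⇒≤ z<x)) (sym (Σ<-pick x (λ y → δ (k + y) x) z<x))

  -- Multiplicities in a strictly decreasing list are 0 or 1, so each product marks a pair at
  -- distance `suc k`. A new largest entry `x` adds the pairs with `x` on top and, by `cross`, none
  -- with `x` below.
  count-Δ : ∀ {M xs} k → StrictlyDecreasing xs → All (_< M) xs →
            count (suc k) (Δ xs) ≡ Σ< M (λ y → count (suc k + y) xs * count y xs)
  count-Δ {M} k [] [] = sym (Σ<-zero M (λ _ → refl))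
  count-Δ {M} {x ∷ xs} k (x> ∷ sxs) (x<M ∷ xs<M) = begin
    count (suc k) (map (x ∸_) xs ++ Δ xs)                         ≡⟨ count-++ (suc k) (map (x ∸_) xs) _ ⟩
    count (suc k) (map (x ∸_) xs) + count (suc k) (Δ xs)          ≡⟨ cong₂ _+_ (trans (count-map-∸ (suc k) xs x>) widen) (count-Δ k sxs xs<M) ⟩
    Σ< M (λ y → δ (suc k + y) x * count y xs) + Σ< M (λ y → count (suc k + y) xs * count y xs)
                                                                  ≡⟨ Σ<-+ M (λ y → δ (suc k + y) x * count y xs) _ ⟨
    Σ< M (λ y → δ (suc k + y) x * count y xs + count (suc k + y) xs * count y xs)
                                                                  ≡⟨ Σ<-cong M pointwise ⟩
    Σ< M (λ y → (δ (suc k + y) x + count (suc k + y) xs) * (δ y x + count y xs)) ∎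
    where
    open ≡-Reasoning
    widen : Σ< x (λ y → δ (suc k + y) x * count y xs) ≡ Σ< M (λ y → δ (suc k + y) x * count y xs)
    widen = sym (trans (cong (λ n → Σ< n f) (sym (m+[n∸m]≡n (<⇒≤ x<M))))
      (trans (Σ<-split x (M ∸ x) f) (trans (cong (Σ< x f +_) (Σ<-zero (M ∸ x) λ {y} _ →
        trans (cong (δ (suc k + (x + y)) x *_) (count-∉ xs (∉-≥bound x> (m≤m+n x y)))) (*-zeroʳ (δ (suc k + (x + y)) x)))) (+-identityʳ _))))
      where
      f : ℕ → ℕ
      f y = δ (suc k + y) x * count y xs
    cross : ∀ y → (δ (suc k + y) x + count (suc k + y) xs) * δ y x ≡ 0
    cross y with y ≟ x
    ... | yes refl = cong (_* δ y x) (cong₂ _+_ (δ-≢ (λ eq → m≢1+n+m x {k} (sym eq)))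
                       (count-∉ xs (∉-≥bound x> (m≤n+m x (suc k)))))
    ... | no  y≢x  = trans (cong ((δ (suc k + y) x + count (suc k + y) xs) *_) (δ-≢ y≢x)) (*-zeroʳ (δ (suc k + y) x + count (suc k + y) xs))
    pointwise : ∀ y → δ (suc k + y) x * count y xs + count (suc k + y) xs * count y xs
                    ≡ (δ (suc k + y) x + count (suc k + y) xs) * (δ y x + count y xs)
    pointwise y = trans (sym (*-distribʳ-+ (count y xs) (δ (suc k + y) x) (count (suc k + y) xs)))
      (sym (trans (*-distribˡ-+ (δ (suc k + y) x + count (suc k + y) xs) (δ y x) (count y xs)) (cong (_+ (δ (suc k + y) x + count (suc k + y) xs) * count y xs) (cross y))))

  -- Y is the indicator function of a set S of integers, moved up by t, and Z that
  -- of its complement; D is that of (S + t) ∖ S.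
  module SecondDifference
    (t M : ℕ) (Y Z D : ℕ → ℕ)
    (Y+Z : ∀ x → Y x + Z x ≡ 1)
    (Y-step : ∀ x → Y x ≡ Y (t + x) + D x)
    (Y-init : ∀ {x} → x < t → Y x ≡ 1)
    (Y-final : ∀ {x} → M ≤ x → Y x ≡ 0)
    where

    open ≡-Reasoning

    -- `h k` counts the hooks of length `k`. Its difference along a step of `t` is `a`, the pairs of
    -- an element of S above an element of V; the difference of `a` is `d`, the pairs inside V.
    h a d : ℕ → ℕ
    h k = Σ< M λ x → Y (k + x) * Z x
    a k = Σ< M λ x → Y (k + (t + x)) * D x
    d k = Σ< M λ x → D (k + x) * D x

    Z-step : ∀ x → Z (t + x) ≡ Z x + D x
    Z-step x = +-cancelˡ-≡ (Y (t + x)) _ _ (begin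
      Y (t + x) + Z (t + x)      ≡⟨ trans (Y+Z (t + x)) (sym (Y+Z x)) ⟩
      Y x + Z x                  ≡⟨ cong (_+ Z x) (Y-step x) ⟩
      Y (t + x) + D x + Z x      ≡⟨ +-assoc (Y (t + x)) _ _ ⟩
      Y (t + x) + (D x + Z x)    ≡⟨ cong (Y (t + x) +_) (+-comm (D x) _) ⟩
      Y (t + x) + (Z x + D x)    ∎)

    Z-init : ∀ {x} → x < t → Z x ≡ 0
    Z-init {x} x<t = +-cancelˡ-≡ 1 _ _ (trans (cong (_+ Z x) (sym (Y-init x<t))) (Y+Z x))

    YZ≡0 : ∀ x → Y x * Z x ≡ 0
    YZ≡0 x with Y x | Y+Z x
    ... | zero  | _  = refl
    ... | suc y | eq = trans (cong (suc y *_) (m+n≡0⇒n≡0 y (suc-injective eq))) (*-zeroʳ y)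

    h-zero : h 0 ≡ 0
    h-zero = Σ<-zero M λ {x} _ → YZ≡0 x

    -- No element of the complement of S sits on the first `t` places, so up to `t` of them may be
    -- skipped.
    h-shift : ∀ s k → s ≤ t → h k ≡ Σ< M λ x → Y (k + (s + x)) * Z (s + x)
    h-shift s k s≤t = Σ<-shift₀ s M _
      (λ {x} x<s → trans (cong (Y (k + x) *_) (Z-init (<-≤-trans x<s s≤t))) (*-zeroʳ (Y (k + x))))
      (λ {x} M≤x → cong (_* Z x) (Y-final (≤-trans M≤x (m≤n+m x k))))

    +-swap : ∀ k x → t + k + x ≡ k + (t + x)
    +-swap k x = trans (cong (_+ x) (+-comm t k)) (+-assoc k t x)

    h-step : ∀ k → h k ≡ h (t + k) + a k
    h-step k = begin
      h k                                                       ≡⟨ h-shift t k ≤-refl ⟩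
      Σ< M (λ x → Y (k + (t + x)) * Z (t + x))                  ≡⟨ Σ<-cong M pointwise ⟩
      Σ< M (λ x → Y (t + k + x) * Z x + Y (k + (t + x)) * D x)  ≡⟨ Σ<-+ M (λ x → Y (t + k + x) * Z x) _ ⟩
      h (t + k) + a k                                           ∎
      where
      pointwise : ∀ x → Y (k + (t + x)) * Z (t + x) ≡ Y (t + k + x) * Z x + Y (k + (t + x)) * D x
      pointwise x = begin
        Y (k + (t + x)) * Z (t + x)                        ≡⟨ cong (Y (k + (t + x)) *_) (Z-step x) ⟩
        Y (k + (t + x)) * (Z x + D x)                      ≡⟨ *-distribˡ-+ (Y (k + (t + x))) (Z x) _ ⟩
        Y (k + (t + x)) * Z x + Y (k + (t + x)) * D x      ≡⟨ cong (λ y → Y y * Z x + Y (k + (t + x)) * D x) (+-swap k x) ⟨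
        Y (t + k + x) * Z x + Y (k + (t + x)) * D x        ∎

    a-step : ∀ k → a k ≡ a (t + k) + d (t + k)
    a-step k = trans (Σ<-cong M pointwise) (Σ<-+ M (λ x → Y (t + k + (t + x)) * D x) _)
      where
      pointwise : ∀ x → Y (k + (t + x)) * D x ≡ Y (t + k + (t + x)) * D x + D (t + k + x) * D x
      pointwise x = begin
        Y (k + (t + x)) * D x                                     ≡⟨ cong (_* D x) (Y-step (k + (t + x))) ⟩
        (Y (t + (k + (t + x))) + D (k + (t + x))) * D x           ≡⟨ cong₂ (λ i j → (Y i + D j) * D x) (+-assoc t k (t + x)) (+-swap k x) ⟨
        (Y (t + k + (t + x)) + D (t + k + x)) * D x               ≡⟨ *-distribʳ-+ (D x) (Y (t + k + (t + x))) _ ⟩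
        Y (t + k + (t + x)) * D x + D (t + k + x) * D x           ∎

    ΣY-shift : ∀ s → s ≤ t → Σ< M Y ≡ s + Σ< M (λ x → Y (s + x))
    ΣY-shift s s≤t = trans (Σ<-shift s M Y Y-final) (cong (_+ Σ< M (λ x → Y (s + x)))
      (trans (Σ<-const s 1 λ x<s → Y-init (<-≤-trans x<s s≤t)) (*-identityʳ s)))

    -- `Y` and its shift by `t` differ by `D` at each place, and in total by the `t` ones at the
    -- front. Hence V has `t` elements.
    ΣD≡t : Σ< M D ≡ t
    ΣD≡t = +-cancelʳ-≡ (Σ< M λ x → Y (t + x)) _ _ (begin
      Σ< M D + Σ< M (λ x → Y (t + x))        ≡⟨ +-comm (Σ< M D) _ ⟩
      Σ< M (λ x → Y (t + x)) + Σ< M D        ≡⟨ Σ<-+ M (λ x → Y (t + x)) D ⟨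
      Σ< M (λ x → Y (t + x) + D x)           ≡⟨ Σ<-cong M Y-step ⟨
      Σ< M Y                                 ≡⟨ ΣY-shift t ≤-refl ⟩
      t + Σ< M (λ x → Y (t + x))             ∎)

    -- The function k ↦ h k extends to negative k; this is h-step at k - t = - j.
    h-reflect : ∀ k j → k + j ≡ t → h j + j ≡ h k + (d k + a k)
    h-reflect k j k+j≡t = +-cancelʳ-≡ W _ _ (begin
      h j + j + W                                                           ≡⟨ +-assoc (h j) j W ⟩
      h j + (j + W)                                                         ≡⟨ cong (h j +_) (+-comm j W) ⟩
      h j + (W + j)                                                         ≡⟨ +-assoc (h j) W j ⟨
      h j + W + j                                                           ≡⟨ cong (λ n → n + W + j) h-j ⟩
      Σ< M (λ x → Y (t + x) * Z (k + x)) + W + j                            ≡⟨ cong (_+ j) (Σ<-+ M (λ x → Y (t + x) * Z (k + x)) _) ⟨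
      Σ< M (λ x → Y (t + x) * Z (k + x) + Y (t + x) * Y (k + x)) + j        ≡⟨ cong (_+ j) (Σ<-cong M λ x → total (Y (t + x)) (k + x)) ⟩
      Σ< M (λ x → Y (t + x)) + j                                            ≡⟨ +-comm _ j ⟩
      j + Σ< M (λ x → Y (t + x))                                            ≡⟨ ΣY-k ⟨
      Σ< M (λ x → Y (k + x))                                                ≡⟨ Σ<-cong M (λ x → total (Y (k + x)) (t + x)) ⟨
      Σ< M (λ x → Y (k + x) * Z (t + x) + Y (k + x) * Y (t + x))            ≡⟨ Σ<-cong M (λ x → cong₂ _+_ (split x) (*-comm (Y (k + x)) _)) ⟩
      Σ< M (λ x → (Y (k + x) * Z x + (D (k + x) * D x + Y (k + (t + x)) * D x)) + Y (t + x) * Y (k + x))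
                                                                            ≡⟨ Σ<-+ M (λ x → Y (k + x) * Z x + (D (k + x) * D x + Y (k + (t + x)) * D x)) _ ⟩
      Σ< M (λ x → Y (k + x) * Z x + (D (k + x) * D x + Y (k + (t + x)) * D x)) + W
                                                                            ≡⟨ cong (_+ W) (Σ<-+ M (λ x → Y (k + x) * Z x) _) ⟩
      h k + Σ< M (λ x → D (k + x) * D x + Y (k + (t + x)) * D x) + W        ≡⟨ cong (λ n → h k + n + W) (Σ<-+ M (λ x → D (k + x) * D x) _) ⟩
      h k + (d k + a k) + W                                                 ∎)
      where
      -- Pairs with both places occupied. Added to each side, they complete every product with `Z`
      -- to a plain sum of `Y`; the sums for the shifts by `k` and by `t` then differ by `j`.
      W : ℕ
      W = Σ< M λ x → Y (t + x) * Y (k + x)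
      k≤t : k ≤ t
      k≤t = subst (k ≤_) k+j≡t (m≤m+n k j)
      h-j : h j ≡ Σ< M (λ x → Y (t + x) * Z (k + x))
      h-j = trans (h-shift k j k≤t) (Σ<-cong M λ x → cong (λ n → Y n * Z (k + x))
        (trans (sym (+-assoc j k x)) (cong (_+ x) (trans (+-comm j k) k+j≡t))))
      total : ∀ y x → y * Z x + y * Y x ≡ y
      total y x = trans (sym (*-distribˡ-+ y (Z x) (Y x)))
        (trans (cong (y *_) (trans (+-comm (Z x) _) (Y+Z x))) (*-identityʳ y))
      ΣY-k : Σ< M (λ x → Y (k + x)) ≡ j + Σ< M (λ x → Y (t + x))
      ΣY-k = +-cancelˡ-≡ k _ _ (begin
        k + Σ< M (λ x → Y (k + x))           ≡⟨ ΣY-shift k k≤t ⟨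
        Σ< M Y                               ≡⟨ ΣY-shift t ≤-refl ⟩
        t + Σ< M (λ x → Y (t + x))           ≡⟨ cong (_+ Σ< M (λ x → Y (t + x))) k+j≡t ⟨
        k + j + Σ< M (λ x → Y (t + x))       ≡⟨ +-assoc k j _ ⟩
        k + (j + Σ< M (λ x → Y (t + x)))     ∎)
      split : ∀ x → Y (k + x) * Z (t + x) ≡ Y (k + x) * Z x + (D (k + x) * D x + Y (k + (t + x)) * D x)
      split x = begin
        Y (k + x) * Z (t + x)                                            ≡⟨ cong (Y (k + x) *_) (Z-step x) ⟩
        Y (k + x) * (Z x + D x)                                          ≡⟨ *-distribˡ-+ (Y (k + x)) (Z x) _ ⟩
        Y (k + x) * Z x + Y (k + x) * D x                                ≡⟨ cong (λ y → Y (k + x) * Z x + y * D x) (Y-step (k + x)) ⟩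
        Y (k + x) * Z x + (Y (t + (k + x)) + D (k + x)) * D x            ≡⟨ cong (λ y → Y (k + x) * Z x + y * D x) (+-comm _ (D (k + x))) ⟩
        Y (k + x) * Z x + (D (k + x) + Y (t + (k + x))) * D x            ≡⟨ cong (λ y → Y (k + x) * Z x + (D (k + x) + Y y) * D x) (trans (sym (+-assoc t k x)) (+-swap k x)) ⟩
        Y (k + x) * Z x + (D (k + x) + Y (k + (t + x))) * D x            ≡⟨ cong (Y (k + x) * Z x +_) (*-distribʳ-+ (D x) (D (k + x)) _) ⟩
        Y (k + x) * Z x + (D (k + x) * D x + Y (k + (t + x)) * D x)      ∎

    second-difference : ∀ k → h k + h (t + (t + k)) ≡ h (t + k) + h (t + k) + d (t + k)
    second-difference k = begin
      h k + u                            ≡⟨ cong (_+ u) (trans (h-step k) (cong (v +_) (a-step k))) ⟩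
      v + (w + d (t + k)) + u            ≡⟨ solve 4 (λ v w d u → v :+ (w :+ d) :+ u := v :+ (u :+ w) :+ d) refl v w (d (t + k)) u ⟩
      v + (u + w) + d (t + k)            ≡⟨ cong (λ n → v + n + d (t + k)) (h-step (t + k)) ⟨
      v + v + d (t + k)                  ∎
      where
      open +-*-Solver
      u v w : ℕ
      u = h (t + (t + k))
      v = h (t + k)
      w = a (t + k)

    -- `h j + j` is the count at k - t = - j. Since S is full far below and empty far above, the
    -- pairs with x in S and x + j outside outnumber the pairs with x outside and x + j in S by
    -- exactly `j`.
    second-difference-reflected : ∀ k j → k + j ≡ t → h j + j + h (t + k) ≡ h k + h k + d k
    second-difference-reflected k j k+j≡t = begin
      h j + j + h (t + k)                ≡⟨ cong (_+ h (t + k)) (h-reflect k j k+j≡t) ⟩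
      h k + (d k + a k) + h (t + k)      ≡⟨ solve 4 (λ v w d u → v :+ (d :+ w) :+ u := v :+ (u :+ w) :+ d) refl (h k) (a k) (d k) (h (t + k)) ⟩
      h k + (h (t + k) + a k) + d k      ≡⟨ cong (λ n → h k + n + d k) (h-step k) ⟨
      h k + h k + d k                    ∎
      where open +-*-Solver

  -- For `f` the indicator of a set of natural numbers, this is the indicator of that set together
  -- with the negative integers, moved up by `t` and restricted to ℕ.
  ext : ℕ → (ℕ → ℕ) → ℕ → ℕ
  ext zero    f x       = f x
  ext (suc t) f zero    = 1
  ext (suc t) f (suc x) = ext t f x

  ext-< : ∀ {t} f {x} → x < t → ext t f x ≡ 1
  ext-< f {zero}  (s≤s x<t) = refl
  ext-< f {suc x} (s≤s x<t) = ext-< f x<t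

  ext-+ : ∀ t f x → ext t f (t + x) ≡ f x
  ext-+ zero    f x = refl
  ext-+ (suc t) f x = ext-+ t f x

  ext-≤1 : ∀ t {f} → (∀ x → f x ≤ 1) → ∀ x → ext t f x ≤ 1
  ext-≤1 zero    f≤1 x       = f≤1 x
  ext-≤1 (suc t) f≤1 zero    = ≤-refl
  ext-≤1 (suc t) f≤1 (suc x) = ext-≤1 t f≤1 x

  -- Hooks and first-column hooks

  legs : List ℕ → ℕ → ℕ
  legs ps j = length (filter (j ≤?_) ps)

  rowHooks : ℕ → List ℕ → List ℕ
  rowHooks p ps = map (λ j → suc (p ∸ j + legs ps j)) [1… p ]

  hooks : List ℕ → List ℕ
  hooks []       = []
  hooks (p ∷ ps) = rowHooks p ps ++ hooks ps

  beta : List ℕ → List ℕ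
  beta []       = []
  beta (p ∷ ps) = (p + length ps) ∷ beta ps

  -- On strictly decreasing lists the subtraction is exact, by `strictly-length≤`.
  unbeta : List ℕ → List ℕ
  unbeta []       = []
  unbeta (x ∷ xs) = (x ∸ length xs) ∷ unbeta xs

  ++-interchange : ∀ (as bs cs ds : List ℕ) → (as ++ bs) ++ (cs ++ ds) ↭ (as ++ cs) ++ (bs ++ ds)
  ++-interchange = interchange
    where open import Algebra.Properties.CommutativeSemigroup
            (CommutativeMonoid.commutativeSemigroup (++-commutativeMonoid {A = ℕ}))

  length-beta : ∀ ps → length (beta ps) ≡ length ps
  length-beta []       = refl
  length-beta (p ∷ ps) = cong suc (length-beta ps)

  length-unbeta : ∀ xs → length (unbeta xs) ≡ length xs
  length-unbeta []       = refl
  length-unbeta (x ∷ xs) = cong suc (length-unbeta xs)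

  unbeta-beta : ∀ ps → unbeta (beta ps) ≡ ps
  unbeta-beta []       = refl
  unbeta-beta (p ∷ ps) = cong₂ _∷_ (trans (cong (p + length ps ∸_) (length-beta ps)) (m+n∸n≡m p (length ps))) (unbeta-beta ps)

  strictly-length≤ : ∀ {x xs} → All (_< x) xs → StrictlyDecreasing xs → length xs ≤ x
  strictly-length≤ []        _           = z≤n
  strictly-length≤ (y<x ∷ _) (y> ∷ sys)  = ≤-<-trans (strictly-length≤ y> sys) y<x

  beta-unbeta : ∀ {xs} → StrictlyDecreasing xs → beta (unbeta xs) ≡ xs
  beta-unbeta []                  = refl
  beta-unbeta {x ∷ xs} (x> ∷ sxs) = cong₂ _∷_
    (trans (cong (x ∸ length xs +_) (length-unbeta xs)) (m∸n+n≡m (strictly-length≤ x> sxs))) (beta-unbeta sxs)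

  beta-bound : ∀ {p ps} → All (_≤ p) ps → WeaklyDecreasing ps → All (_< p + length ps) (beta ps)
  beta-bound             []         _          = []
  beta-bound {p} {q ∷ qs} (q≤p ∷ _) (q≥ ∷ wqs) = +-mono-≤-< q≤p ≤-refl ∷
    All.map (λ z<q → <-trans z<q (+-mono-≤-< q≤p ≤-refl)) (beta-bound q≥ wqs)

  beta-decreasing : ∀ {ps} → WeaklyDecreasing ps → StrictlyDecreasing (beta ps)
  beta-decreasing []         = []
  beta-decreasing (p≥ ∷ wps) = beta-bound p≥ wps ∷ beta-decreasing wps

  unbeta-bound : ∀ {x xs} → All (_< x) xs → StrictlyDecreasing xs → All (_≤ x ∸ length xs) (unbeta xs)
  unbeta-bound []        _          = []
  unbeta-bound {x} {y ∷ ys} (y<x ∷ _) (y> ∷ sys) = y≤ ∷ All.map (λ z≤ → ≤-trans z≤ y≤) (unbeta-bound y> sys)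
    where
    y≤ : y ∸ length ys ≤ x ∸ suc (length ys)
    y≤ = ∸-monoˡ-≤ (suc (length ys)) y<x

  unbeta-decreasing : ∀ {xs} → StrictlyDecreasing xs → WeaklyDecreasing (unbeta xs)
  unbeta-decreasing []         = []
  unbeta-decreasing (x> ∷ sxs) = unbeta-bound x> sxs ∷ unbeta-decreasing sxs

  beta-positive : ∀ {ps} → All (0 <_) ps → All (0 <_) (beta ps)
  beta-positive []         = []
  beta-positive (0<p ∷ ps) = m≤n⇒m≤n+o _ 0<p ∷ beta-positive ps

  unbeta-positive : ∀ {xs} → StrictlyDecreasing xs → All (0 <_) xs → All (0 <_) (unbeta xs)
  unbeta-positive []         []           = []
  unbeta-positive {x ∷ xs} (x> ∷ sxs) (0<x ∷ 0<xs) = m<n⇒0<n∸m (len< 0<x x> sxs 0<xs) ∷ unbeta-positive sxs 0<xs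
    where
    len< : ∀ {x xs} → 0 < x → All (_< x) xs → StrictlyDecreasing xs → All (0 <_) xs → length xs < x
    len< 0<x []        _          _            = 0<x
    len< 0<x (y<x ∷ _) (y> ∷ sys) (0<y ∷ 0<ys) = ≤-<-trans (len< 0<y y> sys 0<ys) y<x

  [1…suc]↭ : ∀ n → suc n ∷ [1… n ] ↭ [1… suc n ]
  [1…suc]↭ n = ↭-trans (∷↭∷ʳ (suc n) [1… n ]) (↭-reflexive (applyUpTo-∷ʳ suc n))

  rowHooks-[] : ∀ p → rowHooks p [] ↭ [1… p ]
  rowHooks-[] zero    = ↭-refl
  rowHooks-[] (suc p) = ↭-trans (↭-reflexive (cong₂ _∷_ (cong suc (+-identityʳ p)) eq))
    (↭-trans (prep (suc p) (rowHooks-[] p)) ([1…suc]↭ p))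
    where
    f : ℕ → ℕ → ℕ
    f n j = suc (n ∸ j + 0)
    eq : map (f (suc p)) (applyUpTo (suc ∘ suc) p) ≡ map (f p) [1… p ]
    eq = trans (map-applyUpTo _ (f (suc p)) p) (sym (map-applyUpTo suc (f p) p))

  -- Split row p at column q, the length of the next row: the columns up to q
  -- have the hooks of that row, shifted by suc (p ∸ q), and the others have the
  -- hooks of a single row of length p ∸ q.
  rowHooks-∷ : ∀ d {q qs} → All (_≤ q) qs →
               rowHooks (d + q) (q ∷ qs) ≡ map (suc d +_) (rowHooks q qs) ++ rowHooks d []
  rowHooks-∷ d {q} {qs} qs≤q = begin
    map f [1… d + q ]                                     ≡⟨ cong (λ n → map f [1… n ]) (+-comm d q) ⟩
    map f [1… q + d ]                                     ≡⟨ map-applyUpTo suc f (q + d) ⟩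
    applyUpTo (f ∘ suc) (q + d)                           ≡⟨ applyUpTo-++ (f ∘ suc) q d ⟩
    applyUpTo (f ∘ suc) q ++ applyUpTo (f ∘ suc ∘ (q +_)) d
                                                          ≡⟨ cong₂ _++_ (applyUpTo-cong q inside) (applyUpTo-cong d outside) ⟩
    applyUpTo ((suc d +_) ∘ g ∘ suc) q ++ applyUpTo (e ∘ suc) d
                                                          ≡⟨ cong₂ _++_ (map-applyUpTo (g ∘ suc) (suc d +_) q) (map-applyUpTo suc e d) ⟨
    map (suc d +_) (applyUpTo (g ∘ suc) q) ++ map e [1… d ] ≡⟨ cong (λ xs → map (suc d +_) xs ++ map e [1… d ]) (map-applyUpTo suc g q) ⟨
    map (suc d +_) (map g [1… q ]) ++ map e [1… d ]       ∎
    where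
    open ≡-Reasoning
    f g e : ℕ → ℕ
    f j = suc (d + q ∸ j + legs (q ∷ qs) j)
    g j = suc (q ∸ j + legs qs j)
    e j = suc (d ∸ j + 0)
    inside : ∀ {i} → i < q → f (suc i) ≡ suc d + g (suc i)
    inside {i} i<q = begin
      suc (d + q ∸ suc i + legs (q ∷ qs) (suc i))      ≡⟨ cong (λ l → suc (d + q ∸ suc i + length l)) (filter-accept (suc i ≤?_) i<q) ⟩
      suc (d + q ∸ suc i + suc (legs qs (suc i)))      ≡⟨ cong (λ n → suc (n + suc (legs qs (suc i)))) (+-∸-assoc d i<q) ⟩
      suc (d + (q ∸ suc i) + suc (legs qs (suc i)))    ≡⟨ cong suc (+-assoc d (q ∸ suc i) _) ⟩
      suc (d + (q ∸ suc i + suc (legs qs (suc i))))    ≡⟨ cong (λ n → suc (d + n)) (+-suc (q ∸ suc i) _) ⟩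
      suc d + g (suc i)                                ∎
    outside : ∀ {i} → i < d → f (suc (q + i)) ≡ e (suc i)
    outside {i} _ = cong suc (cong₂ _+_
      (trans (cong₂ _∸_ (+-comm d q) (sym (+-suc q i))) ([m+n]∸[m+o]≡n∸o q d (suc i)))
      (cong length (filter-none (suc (q + i) ≤?_) (≤⇒≯ (m≤m+n q i) ∷
        All.map (λ z≤q → ≤⇒≯ (≤-trans z≤q (m≤m+n q i))) qs≤q))))

  -- Induction on the rows below. The hooks and differences of the next row fill {1, ..., n} and
  -- reappear moved up by `suc d`. The missing 1, ..., d are the hooks of the `d` columns that
  -- project beyond the next row, and `suc d` is the difference of the two first-column hooks.
  row-complement : ∀ {p ps} → All (_≤ p) ps → WeaklyDecreasing ps →
                   rowHooks p ps ++ map (p + length ps ∸_) (beta ps) ↭ [1… p + length ps ]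
  row-complement {p} {[]} _ _ = begin
    rowHooks p [] ++ []   ≡⟨ ++-identityʳ _ ⟩
    rowHooks p []         ↭⟨ rowHooks-[] p ⟩
    [1… p ]               ≡⟨ cong [1…_] (+-identityʳ p) ⟨
    [1… p + 0 ]           ∎
    where open PermutationReasoning
  row-complement {p} {q ∷ qs} (q≤p ∷ _) (q≥ ∷ wqs) with p ∸ q | m∸n+n≡m q≤p
  ... | d | refl = begin
    rowHooks (d + q) (q ∷ qs) ++ (N ∸ n) ∷ map (N ∸_) (beta qs)
      ≡⟨ cong₂ _++_ (rowHooks-∷ d q≥) (cong₂ _∷_ top (trans (map-cong-local below) (map-∘ (beta qs)))) ⟩
    (map (suc d +_) (rowHooks q qs) ++ rowHooks d []) ++ suc d ∷ map (suc d +_) (map (n ∸_) (beta qs))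
      ↭⟨ ++⁺ʳ _ (++-comm (map (suc d +_) (rowHooks q qs)) (rowHooks d [])) ⟩
    (rowHooks d [] ++ map (suc d +_) (rowHooks q qs)) ++ suc d ∷ map (suc d +_) (map (n ∸_) (beta qs))
      ↭⟨ ++-interchange (rowHooks d []) (map (suc d +_) (rowHooks q qs)) (suc d ∷ []) _ ⟩
    (rowHooks d [] ++ suc d ∷ []) ++ (map (suc d +_) (rowHooks q qs) ++ map (suc d +_) (map (n ∸_) (beta qs)))
      ≡⟨ cong ((rowHooks d [] ++ suc d ∷ []) ++_) (map-++ (suc d +_) (rowHooks q qs) _) ⟨
    (rowHooks d [] ++ suc d ∷ []) ++ map (suc d +_) (rowHooks q qs ++ map (n ∸_) (beta qs))
      ↭⟨ ++⁺ (++⁺ʳ (suc d ∷ []) (rowHooks-[] d)) (map⁺ (suc d +_) (row-complement q≥ wqs)) ⟩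
    ([1… d ] ++ suc d ∷ []) ++ map (suc d +_) [1… n ]
      ≡⟨ cong (_++ map (suc d +_) [1… n ]) (applyUpTo-∷ʳ suc d) ⟩
    [1… suc d ] ++ map (suc d +_) [1… n ]
      ≡⟨ [1…+] (suc d) n ⟨
    [1… suc d + n ]
      ≡⟨ cong [1…_] N≡ ⟨
    [1… N ] ∎
    where
    open PermutationReasoning
    N n : ℕ
    N = d + q + suc (length qs)
    n = q + length qs
    N≡ : N ≡ suc d + n
    N≡ = trans (+-suc (d + q) (length qs)) (cong suc (+-assoc d q _))
    top : N ∸ n ≡ suc d
    top = trans (cong (_∸ n) N≡) (m+n∸n≡m (suc d) n)
    below : All (λ z → N ∸ z ≡ suc d + (n ∸ z)) (beta qs)
    below = All.map (λ {z} z<n → trans (cong (_∸ z) N≡) (+-∸-assoc (suc d) (<⇒≤ z<n))) (beta-bound q≥ wqs)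

  hooks-complement : ∀ {ps} → WeaklyDecreasing ps → hooks ps ++ Δ (beta ps) ↭ intervals (beta ps)
  hooks-complement []                  = ↭-refl
  hooks-complement {p ∷ ps} (p≥ ∷ wps) = ↭-trans (++-interchange (rowHooks p ps) (hooks ps) _ _)
    (++⁺ (row-complement p≥ wps) (hooks-complement wps))

  -- The numbers n + content: column j of the first row has n + j - 1, and each further row lowers
  -- the offset by one. This is faithful for at most `n` rows, which keeps `pred` from being applied
  -- to 0.
  contents : ℕ → List ℕ → List ℕ
  contents n []       = []
  contents n (p ∷ ps) = map (pred n +_) [1… p ] ++ contents (pred n) ps

  -- An entry `x` with `n` entries after it gives a row of length x - n, whose shifted contents n +
  -- 1, ..., x complete {1, ..., n} to {1, ..., x}.
  contents-complement : ∀ {xs} → StrictlyDecreasing xs →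
    contents (length xs) (unbeta xs) ++ intervals (downFrom (length xs)) ↭ intervals xs
  contents-complement []                  = ↭-refl
  contents-complement {x ∷ xs} (x> ∷ sxs) = begin
    (row ++ contents n (unbeta xs)) ++ ([1… n ] ++ intervals (downFrom n))
      ↭⟨ ++-interchange row _ _ _ ⟩
    (row ++ [1… n ]) ++ (contents n (unbeta xs) ++ intervals (downFrom n))
      ↭⟨ ++⁺ (++-comm row [1… n ]) (contents-complement sxs) ⟩
    ([1… n ] ++ row) ++ intervals xs
      ≡⟨ cong (_++ intervals xs) ([1…+] n (x ∸ n)) ⟨
    [1… n + (x ∸ n) ] ++ intervals xs
      ≡⟨ cong (λ m → [1… m ] ++ intervals xs) (m+[n∸m]≡n (strictly-length≤ x> sxs)) ⟩
    [1… x ] ++ intervals xs ∎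
    where
    open PermutationReasoning
    n : ℕ
    n = length xs
    row : List ℕ
    row = map (n +_) [1… x ∸ n ]

  -- Trailing zero rows

  strip : List ℕ → List ℕ
  strip []           = []
  strip (zero  ∷ ps) = []
  strip (suc p ∷ ps) = suc p ∷ strip ps

  -- `nth` is 0 past the end, so a short list is filled up with zero rows. `strip` and `pad` pass
  -- between the positive parts of μ and the `t` rows that V determines.
  pad : ℕ → List ℕ → List ℕ
  pad n ps = applyUpTo (nth ps) n

  strip-All : ∀ {p} {P : ℕ → Set p} {ps} → All P ps → All P (strip ps)
  strip-All                 []         = []
  strip-All {ps = zero  ∷ _} (px ∷ pxs) = []
  strip-All {ps = suc _ ∷ _} (px ∷ pxs) = px ∷ strip-All pxs

  strip-positive : ∀ ps → All (0 <_) (strip ps)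
  strip-positive []           = []
  strip-positive (zero  ∷ ps) = []
  strip-positive (suc p ∷ ps) = s≤s z≤n ∷ strip-positive ps

  strip-decreasing : ∀ {ps} → WeaklyDecreasing ps → WeaklyDecreasing (strip ps)
  strip-decreasing []                      = []
  strip-decreasing {zero  ∷ _} (_  ∷ _)    = []
  strip-decreasing {suc _ ∷ _} (p≥ ∷ wps)  = strip-All p≥ ∷ strip-decreasing wps

  length-strip : ∀ ps → length (strip ps) ≤ length ps
  length-strip []           = z≤n
  length-strip (zero  ∷ ps) = z≤n
  length-strip (suc p ∷ ps) = s≤s (length-strip ps)

  length-strip-< : ∀ {ps} → 0 ∈ ps → length (strip ps) < length ps
  length-strip-< {zero  ∷ ps} _           = s≤s z≤n
  length-strip-< {suc p ∷ ps} (there 0∈ps) = s≤s (length-strip-< 0∈ps)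

  nth-zeros : ∀ {ps} → All (_≤ 0) ps → ∀ i → nth ps i ≡ 0
  nth-zeros []          i       = refl
  nth-zeros (z≤n ∷ p≤0) zero    = refl
  nth-zeros (z≤n ∷ p≤0) (suc i) = nth-zeros p≤0 i

  nth-strip : ∀ {ps} → WeaklyDecreasing ps → ∀ i → nth (strip ps) i ≡ nth ps i
  nth-strip []                      i       = refl
  nth-strip {zero  ∷ _} (p≥ ∷ _)    i       = sym (nth-zeros (z≤n ∷ p≥) i)
  nth-strip {suc _ ∷ _} (p≥ ∷ wps)  zero    = refl
  nth-strip {suc _ ∷ _} (p≥ ∷ wps)  (suc i) = nth-strip wps i

  legs-zeros : ∀ {ps} → All (_≤ 0) ps → ∀ j → legs ps (suc j) ≡ 0
  legs-zeros p≤0 j = cong length (filter-none (suc j ≤?_) (All.map (λ { z≤n () }) p≤0))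

  legs-strip : ∀ {ps} → WeaklyDecreasing ps → ∀ j → legs (strip ps) (suc j) ≡ legs ps (suc j)
  legs-strip []                      j = refl
  legs-strip {zero  ∷ ps} (p≥ ∷ _)   j = sym (legs-zeros (z≤n ∷ p≥) j)
  legs-strip {suc p ∷ ps} (p≥ ∷ wps) j with suc j ≤? suc p
  ... | yes j≤p = trans (cong length (filter-accept (suc j ≤?_) j≤p))
                    (trans (cong suc (legs-strip wps j)) (sym (cong length (filter-accept (suc j ≤?_) j≤p))))
  ... | no  j≰p = trans (cong length (filter-reject (suc j ≤?_) j≰p))
                    (trans (legs-strip wps j) (sym (cong length (filter-reject (suc j ≤?_) j≰p))))

  hooks-zeros : ∀ {ps} → All (_≤ 0) ps → hooks ps ≡ []
  hooks-zeros []          = refl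
  hooks-zeros (z≤n ∷ p≤0) = hooks-zeros p≤0

  hooks-strip : ∀ {ps} → WeaklyDecreasing ps → hooks (strip ps) ≡ hooks ps
  hooks-strip []                       = refl
  hooks-strip {zero  ∷ ps} (p≥ ∷ _)    = sym (hooks-zeros p≥)
  hooks-strip {suc p ∷ ps} (p≥ ∷ wps)  = cong₂ _++_
    (trans (map-applyUpTo suc _ (suc p)) (trans
      (applyUpTo-cong (suc p) λ {i} _ → cong (λ n → suc (suc p ∸ suc i + n)) (legs-strip wps i))
      (sym (map-applyUpTo suc _ (suc p)))))
    (hooks-strip wps)

  contents-zeros : ∀ n {ps} → All (_≤ 0) ps → contents n ps ≡ []
  contents-zeros n []          = refl
  contents-zeros n (z≤n ∷ p≤0) = contents-zeros (pred n) p≤0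

  contents-strip : ∀ n {ps} → WeaklyDecreasing ps → contents n (strip ps) ≡ contents n ps
  contents-strip n []                       = refl
  contents-strip n {zero  ∷ ps} (p≥ ∷ _)    = sym (contents-zeros (pred n) p≥)
  contents-strip n {suc p ∷ ps} (p≥ ∷ wps)  = cong (map (pred n +_) [1… suc p ] ++_) (contents-strip (pred n) wps)

  pad-nth : ∀ ps → pad (length ps) ps ≡ ps
  pad-nth []       = refl
  pad-nth (p ∷ ps) = cong (p ∷_) (pad-nth ps)

  pad-strip : ∀ {ps} → WeaklyDecreasing ps → pad (length ps) (strip ps) ≡ ps
  pad-strip {ps} wps = trans (applyUpTo-cong (length ps) λ {i} _ → nth-strip wps i) (pad-nth ps)

  strip-pad : ∀ n {ps} → All (0 <_) ps → length ps ≤ n → strip (pad n ps) ≡ ps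
  strip-pad zero    {[]}         _           _         = refl
  strip-pad (suc n) {[]}         _           _         = refl
  strip-pad (suc n) {suc p ∷ ps} (_ ∷ 0<ps) (s≤s l≤n)  = cong (suc p ∷_) (strip-pad n 0<ps l≤n)

  pad-decreasing : ∀ n {ps} → WeaklyDecreasing ps → WeaklyDecreasing (pad n ps)
  pad-decreasing zero    _ = []
  pad-decreasing (suc n) {[]}     _          = zeros n ∷ pad-decreasing n []
    where
    zeros : ∀ n → All (_≤ 0) (pad n [])
    zeros zero    = []
    zeros (suc n) = z≤n ∷ zeros n
  pad-decreasing (suc n) {p ∷ ps} (p≥ ∷ wps) = bound n p≥ ∷ pad-decreasing n wps
    where
    bound : ∀ n {qs} → All (_≤ p) qs → All (_≤ p) (pad n qs)
    bound zero    _          = []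
    bound (suc n) []         = z≤n ∷ bound n []
    bound (suc n) (q≤ ∷ qs≤) = q≤ ∷ bound n qs≤

  -- With fewer than `n` parts the last of the `n` rows is zero and has nothing below it, so its
  -- first-column hook is 0. This turns the bound t - 1 on the length into 0 being in V.
  0∈beta-pad : ∀ n ps → length ps < n → 0 ∈ beta (pad n ps)
  0∈beta-pad (suc zero)    []       _         = here refl
  0∈beta-pad (suc (suc n)) []       _         = there (0∈beta-pad (suc n) [] (s≤s z≤n))
  0∈beta-pad (suc n)       (p ∷ ps) (s≤s l<n) = there (0∈beta-pad n ps l<n)

  0∈unbeta : ∀ {xs} → 0 ∈ xs → 0 ∈ unbeta xs
  0∈unbeta {_ ∷ xs} (here refl)  = here (sym (0∸n≡0 (length xs)))
  0∈unbeta          (there 0∈xs) = there (0∈unbeta 0∈xs)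

  beta-applyUpTo : ∀ ps → beta ps ≡ applyUpTo (λ i → nth ps i + (length ps ∸ suc i)) (length ps)
  beta-applyUpTo []       = refl
  beta-applyUpTo (p ∷ ps) = cong (p + length ps ∷_) (beta-applyUpTo ps)

  map-concat-applyUpTo : ∀ {a b} {A : Set a} {B : Set b} (f : A → B) (g : ℕ → List A) n →
    map f (concatMap g [1… n ]) ≡ concat (applyUpTo (map f ∘ g ∘ suc) n)
  map-concat-applyUpTo f g n = trans (sym (concat-map (map g [1… n ])))
    (cong concat (trans (cong (map (map f)) (map-applyUpTo suc g n)) (map-applyUpTo (g ∘ suc) (map f) n)))

  map-hook-boxes : ∀ μ → map (hook μ) (boxes μ) ≡ hooks (parts μ)
  map-hook-boxes μ = trans (map-concat-applyUpTo (hook μ) _ (len μ))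
    (trans (cong concat (applyUpTo-cong (len μ) λ {i} _ → sym (map-∘ [1… part μ (suc i) ]))) (rows (parts μ)))
    where
    rows : ∀ ps → concat (applyUpTo (λ i → rowHooks (nth ps i) (drop (suc i) ps)) (length ps)) ≡ hooks ps
    rows []       = refl
    rows (p ∷ ps) = cong (rowHooks p ps ++_) (rows ps)

  -- Vacant positions

  bound : List ℕ → ℕ
  bound []      = 0
  bound (x ∷ _) = suc x

  <-bound : ∀ {xs} → StrictlyDecreasing xs → All (_< bound xs) xs
  <-bound []       = []
  <-bound (x> ∷ _) = ≤-refl ∷ All.map m<n⇒m<1+n x>

  count-bound : ∀ {xs k} → StrictlyDecreasing xs → bound xs ≤ k → count k xs ≡ 0
  count-bound {xs} sxs b≤k = count-∉ xs (∉-≥bound (<-bound sxs) b≤k)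

  count-∈ : ∀ {k xs} → StrictlyDecreasing xs → k ∈ xs → count k xs ≡ 1
  count-∈ {k} {xs} sxs k∈xs with count k xs | count-≤1 {k} sxs | ∈⇒count k∈xs
  ... | zero  | _       | c≢0 = ⊥-elim (c≢0 refl)
  ... | suc _ | s≤s z≤n | _   = refl

  filter-downFrom-decreasing : ∀ {p} {P : Pred ℕ p} (P? : Decidable P) M → StrictlyDecreasing (filter P? (downFrom M))
  filter-downFrom-decreasing P? M = AllPairsP.filter⁺ P? (AllPairsP.applyDownFrom⁺₁ id M λ j<i _ → j<i)

  count-positive : ∀ {xs} → All (0 <_) xs → count 0 xs ≡ 0
  count-positive {xs} 0<xs = count-∉ xs λ 0∈xs → <-irrefl refl (All.lookup 0<xs 0∈xs)

  ≤∨+ : ∀ t x → x < t ⊎ ∃ λ y → x ≡ t + y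
  ≤∨+ t x with x <? t
  ... | yes x<t = inj₁ x<t
  ... | no  x≮t = inj₂ (x ∸ t , sym (m+[n∸m]≡n (≮⇒≥ x≮t)))

  rowHooks-positive : ∀ p ps → All (0 <_) (rowHooks p ps)
  rowHooks-positive p ps = AllP.map⁺ (All.universal (λ _ → s≤s z≤n) [1… p ])

  hooks-positive : ∀ ps → All (0 <_) (hooks ps)
  hooks-positive []       = []
  hooks-positive (p ∷ ps) = AllP.++⁺ (rowHooks-positive p ps) (hooks-positive ps)

  -- The inclusion of S - t in S, tested at natural numbers only because every negative integer is
  -- in S.
  Closed : ℕ → List ℕ → Set
  Closed t xs = ∀ x → count (t + x) xs ≤ count x xs

  -- Consider the places at distance `suc k` below an entry. By `hooks-complement` these number as
  -- many as hooks and differences together; the occupied ones account for the differences, so the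
  -- unoccupied ones count the hooks.
  count-hooks : ∀ {ps M} k → WeaklyDecreasing ps → All (_< M) (beta ps) →
    count (suc k) (hooks ps) ≡ Σ< M λ x → count (suc k + x) (beta ps) * (1 ∸ count x (beta ps))
  count-hooks {ps} {M} k wps xs<M = +-cancelʳ-≡ (count (suc k) (Δ xs)) _ _ (begin
    count (suc k) (hooks ps) + count (suc k) (Δ xs)             ≡⟨ count-++ (suc k) (hooks ps) _ ⟨
    count (suc k) (hooks ps ++ Δ xs)                            ≡⟨ count-↭ (suc k) (hooks-complement wps) ⟩
    count (suc k) (intervals xs)                                ≡⟨ count-intervals k xs<M ⟩
    Σ< M (λ x → count (suc k + x) xs)                           ≡⟨ Σ<-cong M split ⟩
    Σ< M (λ x → count (suc k + x) xs * (1 ∸ count x xs) + count (suc k + x) xs * count x xs)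
                                                                ≡⟨ Σ<-+ M (λ x → count (suc k + x) xs * (1 ∸ count x xs)) _ ⟩
    Σ< M (λ x → count (suc k + x) xs * (1 ∸ count x xs)) + Σ< M (λ x → count (suc k + x) xs * count x xs)
                                                                ≡⟨ cong (Σ< M (λ x → count (suc k + x) xs * (1 ∸ count x xs)) +_) (count-Δ k sxs xs<M) ⟨
    Σ< M (λ x → count (suc k + x) xs * (1 ∸ count x xs)) + count (suc k) (Δ xs) ∎)
    where
    open ≡-Reasoning
    xs : List ℕ
    xs = beta ps
    sxs : StrictlyDecreasing xs
    sxs = beta-decreasing wps
    split : ∀ x → count (suc k + x) xs ≡ count (suc k + x) xs * (1 ∸ count x xs) + count (suc k + x) xs * count x xs
    split x = trans (sym (trans (cong (count (suc k + x) xs *_) (m∸n+n≡m (count-≤1 {x} sxs))) (*-identityʳ _)))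
      (*-distribˡ-+ (count (suc k + x) xs) (1 ∸ count x xs) _)

  -- A place where closedness failed would be a nonzero summand in the count of hooks of length `t`.
  hook∤⇒closed : ∀ {t ps} .{{_ : NonZero t}} → WeaklyDecreasing ps → t ∉ hooks ps → Closed t (beta ps)
  hook∤⇒closed {suc t} {ps} wps t∉ x with x <? bound (beta ps)
  ... | no  x≮b = ≤-trans (≤-reflexive (count-bound (beta-decreasing wps) (≤-trans (≮⇒≥ x≮b) (m≤n+m x (suc t))))) z≤n
  ... | yes x<b with count x (beta ps) | Σ<-zero⁻¹ (bound (beta ps)) _ (trans (sym (count-hooks t wps (<-bound (beta-decreasing wps)))) (count-∉ (hooks ps) t∉)) x<b
  ...   | zero  | eq = ≤-reflexive (trans (sym (*-identityʳ _)) eq)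
  ...   | suc c | _  = ≤-trans (count-≤1 {suc t + x} (beta-decreasing wps)) (s≤s z≤n)

  -- Closedness under `t` iterates to every multiple of `t`, and then all summands in the count of
  -- hooks of such a length vanish.
  closed⇒∤hook : ∀ {t ps} → WeaklyDecreasing ps → Closed t (beta ps) → All (t ∤_) (hooks ps)
  closed⇒∤hook {t} {ps} wps closed = All.tabulate λ {k} k∈ t∣k → ∉hooks k t∣k k∈
    where
    closed* : ∀ m x → count (m * t + x) (beta ps) ≤ count x (beta ps)
    closed* zero    x = ≤-refl
    closed* (suc m) x = ≤-trans (≤-reflexive (cong (λ y → count y (beta ps)) (+-assoc t (m * t) x)))
      (≤-trans (closed (m * t + x)) (closed* m x))
    zeros : ∀ k → t ∣ k → ∀ x → count (k + x) (beta ps) * (1 ∸ count x (beta ps)) ≡ 0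
    zeros k (divides m refl) x with count x (beta ps) | closed* m x
    ... | zero  | c≤0 = cong (_* 1) (n≤0⇒n≡0 c≤0)
    ... | suc c | _   = trans (cong (count (m * t + x) (beta ps) *_) (0∸n≡0 c)) (*-zeroʳ (count (m * t + x) (beta ps)))
    ∉hooks : ∀ k → t ∣ k → k ∉ hooks ps
    ∉hooks zero    _   0∈ = <-irrefl refl (All.lookup (hooks-positive ps) 0∈)
    ∉hooks (suc k) t∣k k∈ = ∈⇒count k∈ (trans (count-hooks k wps (<-bound (beta-decreasing wps)))
      (Σ<-zero (bound (beta ps)) λ {x} _ → zeros (suc k) t∣k x))

  occupancy : ℕ → List ℕ → ℕ → ℕ
  occupancy t xs = ext t λ x → count x xs

  -- With S the union of xs and the negative integers, these are the elements of
  -- (S + t) ∖ S: on an abacus with t runners, the first vacant position of each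
  -- runner when all beads are pushed up.
  vacancies : ℕ → List ℕ → List ℕ
  vacancies t xs = filter (λ v → count v xs <? occupancy t xs v) (downFrom (t + bound xs))

  vacancies-decreasing : ∀ t xs → StrictlyDecreasing (vacancies t xs)
  vacancies-decreasing t xs = filter-downFrom-decreasing (λ v → count v xs <? occupancy t xs v) (t + bound xs)

  vacancies-bound : ∀ t xs → All (_< t + bound xs) (vacancies t xs)
  vacancies-bound t xs = AllP.filter⁺ (λ v → count v xs <? occupancy t xs v) (AllP.applyDownFrom⁺₁ id (t + bound xs) id)

  module Vacancies {t : ℕ} {xs : List ℕ} (sxs : StrictlyDecreasing xs) where

    χ Y Z D : ℕ → ℕ
    χ x = count x xs
    Y   = occupancy t xs
    Z x = 1 ∸ Y x
    D x = count x (vacancies t xs)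

    M : ℕ
    M = t + bound xs

    Y≤1 : ∀ x → Y x ≤ 1
    Y≤1 = ext-≤1 t λ x → count-≤1 {x} sxs

    Y+Z : ∀ x → Y x + Z x ≡ 1
    Y+Z x = m+[n∸m]≡n (Y≤1 x)

    Y-init : ∀ {x} → x < t → Y x ≡ 1
    Y-init = ext-< χ

    Y-final : ∀ {x} → M ≤ x → Y x ≡ 0
    Y-final {x} M≤x with ≤∨+ t x
    ... | inj₁ x<t        = ⊥-elim (<-irrefl refl (<-≤-trans x<t (≤-trans (m≤m+n t _) M≤x)))
    ... | inj₂ (y , refl) = trans (ext-+ t χ y) (count-bound sxs (+-cancelˡ-≤ t _ _ M≤x))

    Y>0⇒<M : ∀ {x} → 0 < Y x → x < M
    Y>0⇒<M {x} 0<Y with x <? M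
    ... | yes x<M = x<M
    ... | no  x≮M = ⊥-elim (<-irrefl (sym (Y-final (≮⇒≥ x≮M))) 0<Y)

    ∈-vacancies⁺ : ∀ {v} → χ v < Y v → v ∈ vacancies t xs
    ∈-vacancies⁺ {v} χ<Y = ∈-filter⁺ (λ v → χ v <? Y v) (∈-downFrom⁺ (Y>0⇒<M {v} (≤-<-trans z≤n χ<Y))) χ<Y

    ∈-vacancies⁻ : ∀ {v} → v ∈ vacancies t xs → χ v < Y v
    ∈-vacancies⁻ v∈ = proj₂ (∈-filter⁻ (λ v → χ v <? Y v) {xs = downFrom M} v∈)

    module _ (closed : Closed t xs) where

      χ≤Y : ∀ x → χ x ≤ Y x
      χ≤Y x with ≤∨+ t x
      ... | inj₁ x<t        = ≤-trans (count-≤1 {x} sxs) (≤-reflexive (sym (Y-init x<t)))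
      ... | inj₂ (y , refl) = ≤-trans (closed y) (≤-reflexive (sym (ext-+ t χ y)))

      -- By closedness S is contained in S + t, so the two indicators differ by that of the
      -- difference set V.
      Y≡χ+D : ∀ x → Y x ≡ χ x + D x
      Y≡χ+D x with χ x <? Y x
      ... | yes χ<Y = sym (trans (cong (χ x +_) (count-∈ (vacancies-decreasing t xs) (∈-vacancies⁺ χ<Y)))
                        (trans (+-comm (χ x) 1) (≤-antisym χ<Y (≤-trans (Y≤1 x) (s≤s z≤n)))))
      ... | no  χ≮Y = sym (trans (cong (χ x +_) (count-∉ (vacancies t xs) (χ≮Y ∘ ∈-vacancies⁻)))
                        (trans (+-identityʳ (χ x)) (≤-antisym (χ≤Y x) (≮⇒≥ χ≮Y))))

      Y-step : ∀ x → Y x ≡ Y (t + x) + D x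
      Y-step x = trans (Y≡χ+D x) (cong (_+ D x) (sym (ext-+ t χ x)))

      module S = SecondDifference t M Y Z D Y+Z Y-step Y-init Y-final

      length-vacancies : length (vacancies t xs) ≡ t
      length-vacancies = trans (sym (Σ<-count (vacancies-bound t xs))) S.ΣD≡t

      -- Climb in steps of `t` from an element of S + t: it is either a vacancy or in S, and in the
      -- second case the next place is again in S + t. Since `Y` vanishes from `M` on, the climb
      -- ends; `n` bounds its remaining length.
      vacancy-% : .{{_ : NonZero t}} → ∀ x → 0 < Y x → ∃ λ v → v ∈ vacancies t xs × v % t ≡ x % t
      vacancy-% x 0<Y = climb M x (m≤m+n M x) 0<Y
        where
        climb : ∀ n x → M ≤ n + x → 0 < Y x → ∃ λ v → v ∈ vacancies t xs × v % t ≡ x % t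
        climb zero    x M≤x 0<Y = ⊥-elim (<-irrefl refl (<-≤-trans (Y>0⇒<M {x} 0<Y) M≤x))
        climb (suc n) x M≤  0<Y with χ x <? Y x
        ... | yes χ<Y = x , ∈-vacancies⁺ χ<Y , refl
        ... | no  χ≮Y with climb n (t + x) (≤-trans M≤ (≤-trans (≤-reflexive (sym (+-suc n x))) (+-monoʳ-≤ n (+-monoˡ-≤ x (>-nonZero⁻¹ t)))))
                             (<-≤-trans 0<Y (≤-trans (≮⇒≥ χ≮Y) (≤-reflexive (sym (ext-+ t χ x)))))
        ...   | v , v∈ , eq = v , v∈ , trans eq (trans (cong (_% t) (+-comm t x)) ([m+n]%n≡m%n x t))

      vacancy-residue : .{{_ : NonZero t}} → ∀ {r} → r < t → ∃ λ v → v ∈ vacancies t xs × v % t ≡ r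
      vacancy-residue {r} r<t with vacancy-% r (≤-reflexive (sym (Y-init r<t)))
      ... | v , v∈ , eq = v , v∈ , trans eq (m<n⇒m%n≡m r<t)

    0∈vacancies : .{{_ : NonZero t}} → All (0 <_) xs → 0 ∈ vacancies t xs
    0∈vacancies 0<xs = ∈-vacancies⁺ (≤-<-trans (≤-reflexive (count-positive 0<xs))
      (≤-reflexive (sym (Y-init (>-nonZero⁻¹ t)))))

  -- S can be read off V from the bottom upwards: `k` is in S exactly when k - t is in S and `k` is
  -- not in V, and for k < t the number k - t is negative, hence in S.
  vacancies-injective : ∀ {t xs ys} .{{_ : NonZero t}} → StrictlyDecreasing xs → StrictlyDecreasing ys → Closed t xs → Closed t ys →
                        vacancies t xs ≡ vacancies t ys → xs ≡ ys
  vacancies-injective {t} {xs} {ys} sxs sys cxs cys eq = count-injective sxs sys λ k → go (suc k) k ≤-refl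
    where
    module X = Vacancies {t} sxs
    module X′ = Vacancies {t} sys
    go : ∀ n k → k < n → count k xs ≡ count k ys
    go (suc n) k (s≤s k≤n) = +-cancelʳ-≡ (X.D k) _ _ (trans (sym (X.Y≡χ+D cxs k)) (trans Y≡ (trans (X′.Y≡χ+D cys k)
      (cong (λ vs → count k ys + count k vs) (sym eq)))))
      where
      Y≡ : X.Y k ≡ X′.Y k
      Y≡ with ≤∨+ t k
      ... | inj₁ k<t        = trans (X.Y-init k<t) (sym (X′.Y-init k<t))
      ... | inj₂ (j , refl) = trans (ext-+ t _ j) (trans (go n j (<-≤-trans (+-monoˡ-≤ j (>-nonZero⁻¹ t)) k≤n)) (sym (ext-+ t _ j)))

  -- From the vacancies back to the core

  Vacant : ℕ → List ℕ → ℕ → Set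
  Vacant t vs x = Any (λ v → v ≤ x × t ∣ x ∸ v) vs

  vacant? : ∀ t vs → Decidable (Vacant t vs)
  vacant? t vs x = any? (λ v → v ≤? x ×-dec t ∣? x ∸ v) vs

  -- Each class modulo `t` is filled below its element of `vs` and empty from there on. When `vs`
  -- meets every class, nothing is occupied from `bound vs` on, so the finite search misses no
  -- place.
  occupied : ℕ → List ℕ → List ℕ
  occupied t vs = filter (¬? ∘ vacant? t vs) (downFrom (bound vs))

  occupied-decreasing : ∀ t vs → StrictlyDecreasing (occupied t vs)
  occupied-decreasing t vs = filter-downFrom-decreasing (¬? ∘ vacant? t vs) (bound vs)

  module Occupied {t : ℕ} {vs : List ℕ} .{{_ : NonZero t}} (svs : StrictlyDecreasing vs)
    (residues : ∀ {r} → r < t → ∃ λ v → v ∈ vs × v % t ≡ r) where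

    xs : List ℕ
    xs = occupied t vs

    %≡⇒∣∸ : ∀ x v → v % t ≡ x % t → t ∣ x ∸ v
    %≡⇒∣∸ x v eq = divides (x / t ∸ v / t) (begin
      x ∸ v                                             ≡⟨ cong₂ _∸_ (m≡m%n+[m/n]*n x t) (m≡m%n+[m/n]*n v t) ⟩
      x % t + x / t * t ∸ (v % t + v / t * t)           ≡⟨ cong (λ r → x % t + x / t * t ∸ (r + v / t * t)) eq ⟩
      x % t + x / t * t ∸ (x % t + v / t * t)           ≡⟨ [m+n]∸[m+o]≡n∸o (x % t) _ _ ⟩
      x / t * t ∸ v / t * t                             ≡⟨ *-distribʳ-∸ t (x / t) (v / t) ⟨
      (x / t ∸ v / t) * t                               ∎)
      where open ≡-Reasoning

    ∈-occupied⁺ : ∀ {x} → ¬ Vacant t vs x → x ∈ xs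
    ∈-occupied⁺ {x} ¬vac with x <? bound vs
    ... | yes x<b = ∈-filter⁺ (¬? ∘ vacant? t vs) (∈-downFrom⁺ x<b) ¬vac
    ... | no  x≮b with residues (m%n<n x t)
    ...   | v , v∈ , eq = ⊥-elim (¬vac (Any.map (λ { refl → ≤-trans (<⇒≤ (All.lookup (<-bound svs) v∈)) (≮⇒≥ x≮b) , %≡⇒∣∸ x v eq }) v∈))

    ∈-occupied⁻ : ∀ {x} → x ∈ xs → ¬ Vacant t vs x
    ∈-occupied⁻ x∈ = proj₂ (∈-filter⁻ (¬? ∘ vacant? t vs) {xs = downFrom (bound vs)} x∈)

    vacant-+ : ∀ {x} → Vacant t vs x → Vacant t vs (t + x)
    vacant-+ {x} = Any.map λ { {v} (v≤x , t∣) → ≤-trans v≤x (m≤n+m x t) ,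
      subst (t ∣_) (sym (+-∸-assoc t v≤x)) (∣m∣n⇒∣m+n ∣-refl t∣) }

    occupied-closed : Closed t xs
    occupied-closed x with count (t + x) xs ≟ 0
    ... | yes c≡0 = ≤-trans (≤-reflexive c≡0) z≤n
    ... | no  c≢0 = ≤-trans (count-≤1 {t + x} (occupied-decreasing t vs)) (≤-reflexive (sym
      (count-∈ (occupied-decreasing t vs) (∈-occupied⁺ (∈-occupied⁻ (count⇒∈ xs c≢0) ∘ vacant-+)))))

    occupied-positive : 0 ∈ vs → All (0 <_) xs
    occupied-positive 0∈vs = All.tabulate x>0
      where
      x>0 : ∀ {x} → x ∈ xs → 0 < x
      x>0 {zero}  0∈ = ⊥-elim (∈-occupied⁻ 0∈ (Any.map (λ { refl → z≤n , divides 0 refl }) 0∈vs))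
      x>0 {suc x} _  = s≤s z≤n

    -- Both lists have `t` entries, so one inclusion suffices. A vacancy x is not occupied, hence x
    -- = v + m t for some v in `vs`; if m were positive, x - t would be unoccupied too and x would
    -- not be in S + t.
    vacancies-occupied : length vs ≡ t → vacancies t xs ≡ vs
    vacancies-occupied len≡t = ⊆-length⇒≡ (vacancies-decreasing t xs) svs ⊆ (trans (V.length-vacancies occupied-closed) (sym len≡t))
      where
      module V = Vacancies {t} (occupied-decreasing t vs)
      ⊆ : ∀ {x} → x ∈ vacancies t xs → x ∈ vs
      ⊆ {x} x∈ = first (V.∈-vacancies⁻ x∈) (decidable-stable (vacant? t vs x) λ ¬vac →
        <-irrefl (count-∈ (occupied-decreasing t vs) (∈-occupied⁺ ¬vac)) (<-≤-trans (V.∈-vacancies⁻ x∈) (V.Y≤1 x)))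
        where
        first : count x xs < V.Y x → Vacant t vs x → x ∈ vs
        first χ<Y vac with find vac
        ... | v , v∈ , v≤x , divides zero    eq = subst (_∈ vs) (≤-antisym v≤x (m∸n≡0⇒m≤n eq)) v∈
        ... | v , v∈ , v≤x , divides (suc q) eq = ⊥-elim (<-irrefl (sym Y≡0) (≤-<-trans z≤n χ<Y))
          where
          x≡ : x ≡ t + (q * t + v)
          x≡ = trans (sym (m∸n+n≡m v≤x)) (trans (cong (_+ v) eq) (+-assoc t (q * t) v))
          Y≡0 : V.Y x ≡ 0
          Y≡0 = trans (cong V.Y x≡) (trans (ext-+ t _ (q * t + v)) (count-∉ xs λ y∈ → ∈-occupied⁻ y∈
            (lose v∈ (m≤n+m v (q * t) , divides q (m+n∸n≡m (q * t) v)))))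

  -- The multiset identity

  δ-cancel-+ : ∀ t k x → δ (t + k) (t + x) ≡ δ k x
  δ-cancel-+ zero    k x = refl
  δ-cancel-+ (suc t) k x = δ-cancel-+ t k x

  δ-< : ∀ {x y} → x < y → δ x y ≡ 0
  δ-< x<y = δ-≢ (<⇒≢ x<y)

  δ-> : ∀ {x y} → y < x → δ x y ≡ 0
  δ-> y<x = δ-≢ (>⇒≢ y<x)

  δ-∣-∣-far : ∀ {t k} x → t < k → δ k ∣ x - t ∣ ≡ δ (t + k) x
  δ-∣-∣-far {t} {k} x t<k with ≤∨+ t x
  ... | inj₂ (y , refl) = trans (cong (δ k) (trans (∣-∣-comm (t + y) t) (∣m-m+n∣≡n t y))) (sym (δ-cancel-+ t k y))
  ... | inj₁ x<t        = trans (δ-> {k} {∣ x - t ∣} (≤-<-trans (≤-trans (≤-reflexive (m≤n⇒∣m-n∣≡n∸m (<⇒≤ x<t))) (m∸n≤m t x)) t<k))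
                            (sym (δ-> {t + k} {x} (<-≤-trans x<t (m≤m+n t k))))

  -- The equation |x - t| = k has the solutions t + k and t - k = j, which differ because k is
  -- positive.
  δ-∣-∣-near : ∀ {t k j} x → 0 < k → k + j ≡ t → δ k ∣ x - t ∣ ≡ δ (t + k) x + δ j x
  δ-∣-∣-near {t} {k} {j} x 0<k k+j≡t with ≤∨+ t x
  ... | inj₂ (y , refl) = trans (cong (δ k) (trans (∣-∣-comm (t + y) t) (∣m-m+n∣≡n t y)))
    (sym (trans (cong₂ _+_ (δ-cancel-+ t k y) (δ-< {j} {t + y} (<-≤-trans j<t (m≤m+n t y)))) (+-identityʳ _)))
    where
    j<t : j < t
    j<t = subst (j <_) k+j≡t (m<n+m j 0<k)
  ... | inj₁ x<t = trans (trans (cong (δ k) (m≤n⇒∣m-n∣≡n∸m (<⇒≤ x<t))) reflect)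
    (cong (_+ δ j x) (sym (δ-> {t + k} {x} (<-≤-trans x<t (m≤m+n t k)))))
    where
    reflect : δ k (t ∸ x) ≡ δ j x
    reflect with j ≟ x
    ... | yes refl = trans (cong (δ k) (trans (cong (_∸ j) (sym k+j≡t)) (m+n∸n≡m k j))) (trans (δ-refl k) (sym (δ-refl j)))
    ... | no  j≢x  = trans (δ-≢ λ k≡ → j≢x (+-cancelˡ-≡ k j x (trans k+j≡t (sym (trans (cong (_+ x) k≡) (m∸n+n≡m (<⇒≤ x<t))))))) (sym (δ-≢ j≢x))

  count-∣-∣-far : ∀ {t k} xs → t < k → count k (map ∣_- t ∣ xs) ≡ count (t + k) xs
  count-∣-∣-far []       t<k = refl
  count-∣-∣-far (x ∷ xs) t<k = cong₂ _+_ (δ-∣-∣-far x t<k) (count-∣-∣-far xs t<k)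

  count-∣-∣-near : ∀ {t k j} xs → 0 < k → k + j ≡ t → count k (map ∣_- t ∣ xs) ≡ count (t + k) xs + count j xs
  count-∣-∣-near []       0<k eq = refl
  count-∣-∣-near {t} {k} {j} (x ∷ xs) 0<k eq = trans (cong₂ _+_ (δ-∣-∣-near x 0<k eq) (count-∣-∣-near xs 0<k eq))
    (solve 4 (λ a b c d → (a :+ b) :+ (c :+ d) := (a :+ c) :+ (b :+ d)) refl (δ (t + k) x) (δ j x) (count (t + k) xs) (count j xs))
    where open +-*-Solver

  count-+ : ∀ t k xs → count (t + k) (map (t +_) xs) ≡ count k xs
  count-+ t k []       = refl
  count-+ t k (x ∷ xs) = cong₂ _+_ (δ-cancel-+ t k x) (count-+ t k xs)

  count-+-< : ∀ {t k} xs → k < t → count k (map (t +_) xs) ≡ 0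
  count-+-< []           k<t = refl
  count-+-< {t} {k} (x ∷ xs) k<t = cong₂ _+_ (δ-< {k} {t + x} (<-≤-trans k<t (m≤m+n t x))) (count-+-< xs k<t)

  count-intervals-downFrom : ∀ n k → count (suc k) (intervals (downFrom n)) ≡ n ∸ suc k
  count-intervals-downFrom zero    k = refl
  count-intervals-downFrom (suc n) k = trans (count-++ (suc k) [1… n ] _)
    (trans (cong₂ _+_ (count-[1…] k n) (count-intervals-downFrom n k)) (step n k))
    where
    step : ∀ n k → 𝟙≤ (suc k) n + (n ∸ suc k) ≡ n ∸ k
    step zero    zero    = refl
    step zero    (suc k) = refl
    step (suc n) zero    = refl
    step (suc n) (suc k) = step n k

  contents-positive : ∀ n ps → All (0 <_) (contents n ps)
  contents-positive n []       = []
  contents-positive n (p ∷ ps) = AllP.++⁺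
    (AllP.map⁺ (AllP.applyUpTo⁺₂ suc p λ i → m≤n⇒m≤o+n (pred n) (s≤s z≤n)))
    (contents-positive (pred n) ps)

  -- The rows of μ before the trailing zeros are removed; for a core there are `t` of them.
  quotientRows : ℕ → List ℕ → List ℕ
  quotientRows t ps = unbeta (vacancies t (beta ps))

  module Core↦Complete {t : ℕ} {ps : List ℕ} .{{_ : NonZero t}} (wps : WeaklyDecreasing ps) (t∤ : All (t ∤_) (hooks ps)) where

    xs vs qs : List ℕ
    xs = beta ps
    vs = vacancies t xs
    qs = quotientRows t ps

    closed : Closed t xs
    closed = hook∤⇒closed wps λ t∈ → All.lookup t∤ t∈ ∣-refl

    sxs : StrictlyDecreasing xs
    sxs = beta-decreasing wps

    svs : StrictlyDecreasing vs
    svs = vacancies-decreasing t xs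

    module V = Vacancies {t} sxs
    module S = V.S closed

    length-vs : length vs ≡ t
    length-vs = V.length-vacancies closed

    length-qs : length qs ≡ t
    length-qs = trans (length-unbeta vs) length-vs

    wqs : WeaklyDecreasing qs
    wqs = unbeta-decreasing svs

    beta-qs : beta qs ≡ vs
    beta-qs = beta-unbeta svs

    xs<M : All (_< V.M) xs
    xs<M = All.map (m≤n⇒m≤o+n t) (<-bound sxs)

    -- `S.h` sums over places moved up by `t`, `count-hooks` over the places themselves; `h-shift`
    -- aligns the two.
    h≡ : ∀ k → S.h k ≡ count k (hooks ps)
    h≡ zero    = trans S.h-zero (sym (count-positive (hooks-positive ps)))
    h≡ (suc k) = trans (S.h-shift t (suc k) ≤-refl) (trans (Σ<-cong V.M pointwise) (sym (count-hooks k wps xs<M)))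
      where
      pointwise : ∀ x → V.Y (suc k + (t + x)) * V.Z (t + x) ≡ count (suc k + x) xs * (1 ∸ count x xs)
      pointwise x = cong₂ _*_
        (trans (cong V.Y (trans (sym (+-assoc (suc k) t x)) (trans (cong (_+ x) (+-comm (suc k) t)) (+-assoc t (suc k) x)))) (ext-+ t V.χ (suc k + x)))
        (cong (1 ∸_) (ext-+ t V.χ x))

    d≡ : ∀ k → S.d (suc k) ≡ count (suc k) (Δ vs)
    d≡ k = sym (count-Δ k svs (vacancies-bound t xs))

    -- Both sides are `intervals vs`, split once by the hooks of the `t` rows and once by their
    -- contents.
    hooks-contents : hooks qs ++ Δ vs ↭ contents t qs ++ intervals (downFrom t)
    hooks-contents = ↭-trans
      (subst (λ zs → hooks qs ++ Δ zs ↭ intervals zs) beta-qs (hooks-complement wqs))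
      (↭-sym (subst (λ n → contents n qs ++ intervals (downFrom n) ↭ intervals vs) length-vs (contents-complement svs)))

    count-hooks-contents : ∀ k → count (suc k) (hooks qs) + S.d (suc k) ≡ count (suc k) (contents t qs) + (t ∸ suc k)
    count-hooks-contents k = begin
      count (suc k) (hooks qs) + S.d (suc k)              ≡⟨ cong (count (suc k) (hooks qs) +_) (d≡ k) ⟩
      count (suc k) (hooks qs) + count (suc k) (Δ vs)     ≡⟨ count-++ (suc k) (hooks qs) _ ⟨
      count (suc k) (hooks qs ++ Δ vs)                    ≡⟨ count-↭ (suc k) hooks-contents ⟩
      count (suc k) (contents t qs ++ intervals (downFrom t)) ≡⟨ count-++ (suc k) (contents t qs) _ ⟩
      count (suc k) (contents t qs) + count (suc k) (intervals (downFrom t)) ≡⟨ cong (count (suc k) (contents t qs) +_) (count-intervals-downFrom t k) ⟩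
      count (suc k) (contents t qs) + (t ∸ suc k)         ∎
      where open ≡-Reasoning

    far-count near-count : ℕ → ℕ
    far-count  k = count k (map (t +_) (hooks ps))
    near-count k = count k (map ∣_- t ∣ (hooks ps))

    -- For lengths below `t` the term `t ∸ suc k` is the excess of the reflected count; from `t` on
    -- it is 0 and the plain second difference applies. Truncated subtraction thus covers both cases
    -- in one formula.
    second-difference-hooks : ∀ k → far-count (suc k) + near-count (suc k) + (t ∸ suc k)
                            ≡ count (suc k) (hooks ps) + count (suc k) (hooks ps) + S.d (suc k)
    second-difference-hooks k with ≤∨+ t (suc k)
    ... | inj₁ k<t = begin
      far-count (suc k) + near-count (suc k) + j       ≡⟨ cong₂ (λ a b → a + b + j) (count-+-< (hooks ps) k<t) (count-∣-∣-near (hooks ps) (s≤s z≤n) eq) ⟩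
      count (t + suc k) (hooks ps) + count j (hooks ps) + j ≡⟨ cong₂ (λ a b → a + b + j) (h≡ (t + suc k)) (h≡ j) ⟨
      S.h (t + suc k) + S.h j + j                      ≡⟨ trans (+-assoc (S.h (t + suc k)) _ j) (+-comm (S.h (t + suc k)) _) ⟩
      S.h j + j + S.h (t + suc k)                      ≡⟨ S.second-difference-reflected (suc k) j eq ⟩
      S.h (suc k) + S.h (suc k) + S.d (suc k)          ≡⟨ cong (λ a → a + a + S.d (suc k)) (h≡ (suc k)) ⟩
      count (suc k) (hooks ps) + count (suc k) (hooks ps) + S.d (suc k) ∎
      where
      open ≡-Reasoning
      j : ℕ
      j = t ∸ suc k
      eq : suc k + j ≡ t
      eq = m+[n∸m]≡n (<⇒≤ k<t)
    ... | inj₂ (i , k≡) = begin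
      far-count (suc k) + near-count (suc k) + (t ∸ suc k)  ≡⟨ cong₂ _+_ (cong₂ _+_ far near) (m≤n⇒m∸n≡0 (subst (t ≤_) (sym k≡) (m≤m+n t i))) ⟩
      count i (hooks ps) + count (t + suc k) (hooks ps) + 0 ≡⟨ +-identityʳ _ ⟩
      count i (hooks ps) + count (t + suc k) (hooks ps)     ≡⟨ cong₂ _+_ (h≡ i) (trans (cong (λ m → S.h (t + m)) (sym k≡)) (h≡ (t + suc k))) ⟨
      S.h i + S.h (t + (t + i))                             ≡⟨ S.second-difference i ⟩
      S.h (t + i) + S.h (t + i) + S.d (t + i)               ≡⟨ cong (λ m → S.h m + S.h m + S.d m) k≡ ⟨
      S.h (suc k) + S.h (suc k) + S.d (suc k)               ≡⟨ cong (λ a → a + a + S.d (suc k)) (h≡ (suc k)) ⟩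
      count (suc k) (hooks ps) + count (suc k) (hooks ps) + S.d (suc k) ∎
      where
      open ≡-Reasoning
      far : far-count (suc k) ≡ count i (hooks ps)
      far = trans (cong far-count k≡) (count-+ t i (hooks ps))
      near : near-count (suc k) ≡ count (t + suc k) (hooks ps)
      near with t ≟ suc k
      ... | no  t≢k  = count-∣-∣-far (hooks ps) (≤∧≢⇒< (subst (t ≤_) (sym k≡) (m≤m+n t i)) t≢k)
      -- At length `t` itself |x - t| = t has the further solution x = 0, which is no hook length.
      ... | yes t≡k = trans (count-∣-∣-near {j = 0} (hooks ps) (s≤s z≤n) (trans (+-identityʳ (suc k)) (sym t≡k)))
        (trans (cong (count (t + suc k) (hooks ps) +_) (count-positive (hooks-positive ps))) (+-identityʳ _))

    -- `second-difference-hooks` and `count-hooks-contents` carry the pairs in V and the excess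
    -- `t ∸ suc k` on opposite sides, so both cancel in the sum.
    hook-multiset : map (t +_) (hooks ps) ++ map ∣_- t ∣ (hooks ps) ++ hooks qs
                  ↭ contents t qs ++ hooks ps ++ hooks ps
    hook-multiset = count⇒↭ _ _ λ k → trans (count-++₃ k (map (t +_) (hooks ps)) _ (hooks qs))
      (trans (counts k) (sym (count-++₃ k (contents t qs) (hooks ps) (hooks ps))))
      where
      count-++₃ : ∀ k as bs cs → count k (as ++ bs ++ cs) ≡ count k as + (count k bs + count k cs)
      count-++₃ k as bs cs = trans (count-++ k as _) (cong (count k as +_) (count-++ k bs cs))
      counts : ∀ k → far-count k + (near-count k + count k (hooks qs))
                   ≡ count k (contents t qs) + (count k (hooks ps) + count k (hooks ps))
      -- The value 0 occurs on neither side; for |h - t| this is the absence of hooks of length `t`.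
      counts zero = trans
        (cong₂ _+_ (count-positive (AllP.map⁺ (All.universal (λ x → m≤n⇒m≤n+o x (>-nonZero⁻¹ t)) (hooks ps))))
          (cong₂ _+_ (count-positive (AllP.map⁺ (All.map ∤⇒ t∤))) (count-positive (hooks-positive qs))))
        (sym (cong₂ _+_ (count-positive (contents-positive t qs)) (cong (λ a → a + a) (count-positive (hooks-positive ps)))))
        where
        ∤⇒ : ∀ {x} → t ∤ x → 0 < ∣ x - t ∣
        ∤⇒ {x} t∤x = n≢0⇒n>0 λ eq → t∤x (subst (t ∣_) (sym (∣m-n∣≡0⇒m≡n eq)) ∣-refl)
      counts (suc k) = +-cancelʳ-≡ (j + d) _ _ (begin
        f + (n + q) + (j + d)          ≡⟨ solve 5 (λ f n q j d → f :+ (n :+ q) :+ (j :+ d) := (f :+ n :+ j) :+ (q :+ d)) refl f n q j d ⟩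
        (f + n + j) + (q + d)          ≡⟨ cong₂ _+_ (second-difference-hooks k) (count-hooks-contents k) ⟩
        (c + c + d) + (e + j)          ≡⟨ solve 4 (λ c d e j → (c :+ c :+ d) :+ (e :+ j) := e :+ (c :+ c) :+ (j :+ d)) refl c d e j ⟩
        e + (c + c) + (j + d)          ∎)
        where
        open ≡-Reasoning
        open +-*-Solver
        f n q j d c e : ℕ
        f = far-count (suc k)
        n = near-count (suc k)
        q = count (suc k) (hooks qs)
        j = t ∸ suc k
        d = S.d (suc k)
        c = count (suc k) (hooks ps)
        e = count (suc k) (contents t qs)

  -- The bijection

  nth-pad : ∀ ps {n i} → i < n → nth (pad n ps) i ≡ nth ps i
  nth-pad ps = nth-applyUpTo (nth ps)
    where
    nth-applyUpTo : ∀ f {n i} → i < n → nth (applyUpTo f n) i ≡ f i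
    nth-applyUpTo f {suc n} {zero}  _         = refl
    nth-applyUpTo f {suc n} {suc i} (s≤s i<n) = nth-applyUpTo (f ∘ suc) i<n

  partition-≡ : ∀ {μ ν} → parts μ ≡ parts ν → μ ≡ ν
  partition-≡ {mkPartition _ _ _} {mkPartition _ _ _} refl = refl

  refinement-≡ : ∀ {a p} {A : Set a} {P : A → Set p} {x y : Refinement A P} → value x ≡ value y → x ≡ y
  refinement-≡ {x = _ , [ _ ]} {y = _ , [ _ ]} refl = refl

  parts-decreasing : ∀ μ → WeaklyDecreasing (parts μ)
  parts-decreasing (mkPartition ps dec _) = Linked⇒AllPairs ≥-trans (recompute (linked? _≥?_ ps) dec)
    where
    ≥-trans : ∀ {i j k} → i ≥ j → j ≥ k → i ≥ k
    ≥-trans i≥j j≥k = ≤-trans j≥k i≥j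

  parts-positive : ∀ μ → All (0 <_) (parts μ)
  parts-positive (mkPartition ps _ pos) = recompute (All.all? (0 <?_) ps) pos

  core-hooks : ∀ {t} (κ : Core t) → All (t ∤_) (hooks (parts (value κ)))
  core-hooks {t} (ν , [ core ]) = subst (All (t ∤_)) (map-hook-boxes ν)
    (AllP.map⁺ (recompute (All.all? (λ □ → ¬? (t ∣? hook ν □)) (boxes ν)) core))

  negative-%ℕ : ∀ {t} .{{_ : NonZero t}} n → suc n ≤ t → -[1+ n ] ℤ.%ℕ t ≡ (t ∸ suc n) % t
  negative-%ℕ {t} n n<t with m≤n⇒m<n∨m≡n n<t
  -- At a negative integer `_%ℕ_` branches on the remainder `suc n % t`; abstracting it together
  -- with its known value lets the left side reduce.
  ... | inj₁ 1+n<t with suc n % t | m<n⇒m%n≡m 1+n<t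
  ...   | _ | refl = sym (m<n⇒m%n≡m (∸-monoʳ-< {t} (s≤s z≤n) n<t))
  negative-%ℕ {t} n n<t | inj₂ refl with suc n % t | n%n≡0 t
  ...   | _ | refl = sym (trans (cong (_% t) (n∸n≡0 t)) (m<n⇒m%n≡m (s≤s z≤n)))

  shifted-%ℕ : ∀ {t} .{{_ : NonZero t}} p {i} → i ≤ t → (ℤ.+ p ℤ.- ℤ.+ i) ℤ.%ℕ t ≡ (p + (t ∸ i)) % t
  shifted-%ℕ {t} p {i} i≤t with i ≤? p
  ... | yes i≤p = begin
    (ℤ.+ p ℤ.- ℤ.+ i) ℤ.%ℕ t      ≡⟨ cong (ℤ._%ℕ t) (trans (ℤP.m-n≡m⊖n p i) (ℤP.⊖-≥ i≤p)) ⟩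
    (p ∸ i) % t               ≡⟨ [m+n]%n≡m%n (p ∸ i) t ⟨
    (p ∸ i + t) % t           ≡⟨ cong (_% t) (trans (sym (+-∸-comm t i≤p)) (+-∸-assoc p i≤t)) ⟩
    (p + (t ∸ i)) % t         ∎
    where open ≡-Reasoning
  ... | no  i≰p with i ∸ p in eq
  ...   | zero  = ⊥-elim (i≰p (m∸n≡0⇒m≤n eq))
  ...   | suc n = begin
    (ℤ.+ p ℤ.- ℤ.+ i) ℤ.%ℕ t      ≡⟨ cong (ℤ._%ℕ t) (trans (ℤP.m-n≡m⊖n p i) (trans (ℤP.⊖-< (≰⇒> i≰p)) (cong (λ m → ℤ.- (ℤ.+ m)) eq))) ⟩
    -[1+ n ] ℤ.%ℕ t           ≡⟨ negative-%ℕ n (subst (_≤ t) eq (≤-trans (m∸n≤m i p) i≤t)) ⟩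
    (t ∸ suc n) % t           ≡⟨ cong (λ m → (t ∸ m) % t) eq ⟨
    (t ∸ (i ∸ p)) % t         ≡⟨ cong (_% t) t∸[i∸p] ⟩
    (p + (t ∸ i)) % t         ∎
    where
    open ≡-Reasoning
    t∸[i∸p] : t ∸ (i ∸ p) ≡ p + (t ∸ i)
    t∸[i∸p] = begin
      t ∸ (i ∸ p)                       ≡⟨ cong (_∸ (i ∸ p)) (m∸n+n≡m i≤t) ⟨
      t ∸ i + i ∸ (i ∸ p)               ≡⟨ cong (λ m → t ∸ i + m ∸ (i ∸ p)) (m+[n∸m]≡n (≰⇒≥ i≰p)) ⟨
      t ∸ i + (p + (i ∸ p)) ∸ (i ∸ p)   ≡⟨ cong (_∸ (i ∸ p)) (+-assoc (t ∸ i) p _) ⟨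
      t ∸ i + p + (i ∸ p) ∸ (i ∸ p)     ≡⟨ m+n∸n≡m (t ∸ i + p) (i ∸ p) ⟩
      t ∸ i + p                         ≡⟨ +-comm (t ∸ i) p ⟩
      p + (t ∸ i)                       ∎

  -- Adding `t` to μ_i - i gives the first-column hook of row i among `t` rows. The residue
  -- condition on μ therefore says that V meets every class modulo `t`.
  residues-beta : ∀ {t} .{{_ : NonZero t}} μ qs → length qs ≡ t → (∀ {i} → i < t → part μ (suc i) ≡ nth qs i) →
                  map (λ i → (ℤ.+ part μ i ℤ.- ℤ.+ i) ℤ.%ℕ t) [1… t ] ≡ map (_% t) (beta qs)
  residues-beta {t} μ qs refl part≡ = begin
    map (λ i → (ℤ.+ part μ i ℤ.- ℤ.+ i) ℤ.%ℕ t) [1… t ]                ≡⟨ map-applyUpTo suc _ t ⟩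
    applyUpTo (λ i → (ℤ.+ part μ (suc i) ℤ.- ℤ.+ suc i) ℤ.%ℕ t) t      ≡⟨ applyUpTo-cong t (λ {i} i<t → trans (shifted-%ℕ (part μ (suc i)) i<t) (cong (λ p → (p + (t ∸ suc i)) % t) (part≡ i<t))) ⟩
    applyUpTo (λ i → (nth qs i + (t ∸ suc i)) % t) t               ≡⟨ map-applyUpTo _ (_% t) t ⟨
    map (_% t) (applyUpTo (λ i → nth qs i + (t ∸ suc i)) t)        ≡⟨ cong (map (_% t)) (beta-applyUpTo qs) ⟨
    map (_% t) (beta qs)                                           ∎
    where open ≡-Reasoning

  quotient : ℕ → Partition → Partition
  quotient t ν = mkPartition (strip (quotientRows t (parts ν)))
    (AllPairs⇒Linked (strip-decreasing (unbeta-decreasing (vacancies-decreasing t (beta (parts ν))))))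
    (strip-positive (quotientRows t (parts ν)))

  part-quotient : ∀ t ν i → part (quotient t ν) (suc i) ≡ nth (quotientRows t (parts ν)) i
  part-quotient t ν i = nth-strip (unbeta-decreasing (vacancies-decreasing t (beta (parts ν)))) i

  quotient-complete : ∀ {t} .{{_ : NonZero t}} (κ : Core t) →
    len (quotient t (value κ)) ≤ t ∸ 1 × CompleteResidues t (quotient t (value κ))
  quotient-complete {t} κ =
    m+n≤o⇒m≤o∸n (len μ) (≤-trans (≤-reflexive (+-comm (len μ) 1)) (≤-trans
      (length-strip-< (0∈unbeta (V.0∈vacancies (beta-positive (parts-positive ν))))) (≤-reflexive length-qs))) ,
    λ {r} → mk⇔ (λ r∈ → ∈-upTo⁺ (residue< (subst (r ∈_) residues r∈)))
                (λ r∈ → subst (r ∈_) (sym residues) (<residue (∈-upTo⁻ r∈)))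
    where
    ν μ : Partition
    ν = value κ
    μ = quotient t ν
    open Core↦Complete (parts-decreasing ν) (core-hooks κ)
    residues : map (λ i → (ℤ.+ part μ i ℤ.- ℤ.+ i) ℤ.%ℕ t) [1… t ] ≡ map (_% t) vs
    residues = trans (residues-beta μ qs length-qs λ {i} _ → part-quotient t ν i) (cong (map (_% t)) beta-qs)
    residue< : ∀ {r} → r ∈ map (_% t) vs → r < t
    residue< r∈ with ∈-map⁻ (_% t) r∈
    ... | v , _ , refl = m%n<n v t
    <residue : ∀ {r} → r < t → r ∈ map (_% t) vs
    <residue r<t with V.vacancy-residue closed r<t
    ... | v , v∈ , refl = ∈-map⁺ (_% t) v∈

  toComplete : ∀ t .{{_ : NonZero t}} → Core t → CompletePartition t
  toComplete t κ = quotient t (value κ) , [ quotient-complete κ ]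

  toComplete-injective : ∀ t .{{_ : NonZero t}} {κ κ′ : Core t} → toComplete t κ ≡ toComplete t κ′ → κ ≡ κ′
  toComplete-injective t {κ} {κ′} eq = refinement-≡ (partition-≡ (begin
    parts (value κ)                      ≡⟨ unbeta-beta _ ⟨
    unbeta (beta (parts (value κ)))      ≡⟨ cong unbeta (vacancies-injective C.sxs C′.sxs C.closed C′.closed vs≡) ⟩
    unbeta (beta (parts (value κ′)))     ≡⟨ unbeta-beta _ ⟩
    parts (value κ′)                     ∎))
    where
    open ≡-Reasoning
    module C  = Core↦Complete (parts-decreasing (value κ)) (core-hooks κ)
    module C′ = Core↦Complete (parts-decreasing (value κ′)) (core-hooks κ′)
    -- Both lists have `t` rows, so padding the common parts to that length recovers each of them.
    qs≡ : C.qs ≡ C′.qs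
    qs≡ = begin
      C.qs                                ≡⟨ pad-strip C.wqs ⟨
      pad (length C.qs) (strip C.qs)      ≡⟨ cong₂ pad (trans C.length-qs (sym C′.length-qs)) (cong (parts ∘ value) eq) ⟩
      pad (length C′.qs) (strip C′.qs)    ≡⟨ pad-strip C′.wqs ⟩
      C′.qs                               ∎
    vs≡ : C.vs ≡ C′.vs
    vs≡ = trans (sym C.beta-qs) (trans (cong beta qs≡) C′.beta-qs)

  -- For the preimage, V is the list of first-column hooks of μ padded to `t` rows, and S is the set
  -- that `occupied` builds from V.
  toComplete-surjective : ∀ t .{{_ : NonZero t}} (π : CompletePartition t) → ∃ λ κ → toComplete t κ ≡ π
  toComplete-surjective t π@(μ , [ complete ]) = (ν , [ core ]) , refinement-≡ (partition-≡ (begin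
    strip (unbeta (vacancies t (beta (unbeta O.xs))))   ≡⟨ cong (λ ys → strip (unbeta (vacancies t ys))) (beta-unbeta sxs) ⟩
    strip (unbeta (vacancies t O.xs))                   ≡⟨ cong (strip ∘ unbeta) (O.vacancies-occupied (trans (length-beta qs) length-qs)) ⟩
    strip (unbeta (beta qs))                            ≡⟨ cong strip (unbeta-beta qs) ⟩
    strip (pad t (parts μ))                             ≡⟨ strip-pad t (parts-positive μ) (≤-trans len≤ (m∸n≤m t 1)) ⟩
    parts μ                                             ∎))
    where
    open ≡-Reasoning
    len≤ : len μ ≤ t ∸ 1
    len≤ = recompute (len μ ≤? t ∸ 1) (proj₁ complete)
    qs : List ℕ
    qs = pad t (parts μ)
    length-qs : length qs ≡ t
    length-qs = length-applyUpTo (nth (parts μ)) t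
    svs : StrictlyDecreasing (beta qs)
    svs = beta-decreasing (pad-decreasing t (parts-decreasing μ))
    -- The residue condition is available only irrelevantly. Its half about {0, ..., t - 1} is
    -- decidable on a finite list, so `recompute` makes it usable.
    all-residues : All (_∈ map (λ i → (ℤ.+ part μ i ℤ.- ℤ.+ i) ℤ.%ℕ t) [1… t ]) (upTo t)
    all-residues = recompute (All.all? (_∈? map (λ i → (ℤ.+ part μ i ℤ.- ℤ.+ i) ℤ.%ℕ t) [1… t ]) (upTo t))
      (All.tabulate λ r∈ → Equivalence.from (proj₂ complete) r∈)
    residues : ∀ {r} → r < t → ∃ λ v → v ∈ beta qs × v % t ≡ r
    residues {r} r<t with ∈-map⁻ (_% t) (subst (r ∈_) (residues-beta μ qs length-qs (sym ∘ nth-pad (parts μ))) (All.lookup all-residues (∈-upTo⁺ r<t)))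
    ... | v , v∈ , eq = v , v∈ , sym eq
    0∈vs : 0 ∈ beta qs
    0∈vs = 0∈beta-pad t (parts μ) (≤-<-trans len≤ (∸-monoʳ-< {t} (s≤s z≤n) (>-nonZero⁻¹ t)))
    module O = Occupied {t} svs residues
    sxs : StrictlyDecreasing O.xs
    sxs = occupied-decreasing t (beta qs)
    wps : WeaklyDecreasing (unbeta O.xs)
    wps = unbeta-decreasing sxs
    ν : Partition
    ν = mkPartition (unbeta O.xs) (AllPairs⇒Linked wps) (unbeta-positive sxs (O.occupied-positive 0∈vs))
    core : IsCore t ν
    core = AllP.map⁻ (subst (All (t ∤_)) (sym (map-hook-boxes ν))
      (closed⇒∤hook wps (subst (Closed t) (sym (beta-unbeta sxs)) O.occupied-closed)))

  ψ : ∀ t .{{_ : NonZero t}} → Core t ⤖ CompletePartition t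
  ψ t = mk⤖ (toComplete-injective t , λ π → proj₁ (toComplete-surjective t π) , λ { refl → proj₂ (toComplete-surjective t π) })

  -- The size formula

  sum-squares : List ℕ → ℕ
  sum-squares xs = sum (map (λ x → x * x) xs)

  sum-squares-++ : ∀ xs ys → sum-squares (xs ++ ys) ≡ sum-squares xs + sum-squares ys
  sum-squares-++ xs ys = trans (cong sum (map-++ (λ x → x * x) xs ys)) (sum-++ (map (λ x → x * x) xs) _)

  sum-squares-↭ : ∀ {xs ys} → xs ↭ ys → sum-squares xs ≡ sum-squares ys
  sum-squares-↭ xs↭ys = sum-↭ (map⁺ (λ x → x * x) xs↭ys)

  -- The sum of (x - z)² + 2 x z = x² + z² over the entries z.
  sum-squares-differences : ∀ {x} xs → All (_< x) xs →
    sum-squares (map (x ∸_) xs) + 2 * x * sum xs ≡ length xs * (x * x) + sum-squares xs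
  sum-squares-differences {x} []       []   = *-zeroʳ (2 * x)
  sum-squares-differences {x} (z ∷ zs) (z<x ∷ zs<x) with x ∸ z | m∸n+n≡m (<⇒≤ z<x)
  ... | d | refl = begin
    d * d + q + 2 * (d + z) * (z + s)
      ≡⟨ solve 4 (λ d z q s → d :* d :+ q :+ con 2 :* (d :+ z) :* (z :+ s) := (q :+ con 2 :* (d :+ z) :* s) :+ ((d :+ z) :* (d :+ z) :+ z :* z)) refl d z q s ⟩
    q + 2 * (d + z) * s + ((d + z) * (d + z) + z * z)
      ≡⟨ cong (_+ ((d + z) * (d + z) + z * z)) (sum-squares-differences zs zs<x) ⟩
    length zs * ((d + z) * (d + z)) + sum-squares zs + ((d + z) * (d + z) + z * z)
      ≡⟨ solve 4 (λ l x z q → (l :* x :+ q) :+ (x :+ z) := x :+ l :* x :+ (z :+ q)) refl (length zs) ((d + z) * (d + z)) (z * z) (sum-squares zs) ⟩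
    (d + z) * (d + z) + length zs * ((d + z) * (d + z)) + (z * z + sum-squares zs) ∎
    where
    open ≡-Reasoning
    open +-*-Solver
    q s : ℕ
    q = sum-squares (map (d + z ∸_) zs)
    s = sum zs

  -- The variance identity: for n numbers, the squared differences of all pairs sum to n times the
  -- sum of squares minus the square of the sum.
  sum-squares-Δ : ∀ {xs} → StrictlyDecreasing xs → sum-squares (Δ xs) + sum xs * sum xs ≡ length xs * sum-squares xs
  sum-squares-Δ []                  = refl
  sum-squares-Δ {x ∷ xs} (x> ∷ sxs) = +-cancelʳ-≡ (2 * x * s) _ _ (begin
    sum-squares (map (x ∸_) xs ++ Δ xs) + (x + s) * (x + s) + 2 * x * s
      ≡⟨ cong (λ m → m + (x + s) * (x + s) + 2 * x * s) (sum-squares-++ (map (x ∸_) xs) (Δ xs)) ⟩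
    a + b + (x + s) * (x + s) + 2 * x * s
      ≡⟨ solve 4 (λ a b x s → a :+ b :+ (x :+ s) :* (x :+ s) :+ con 2 :* x :* s
           := (a :+ con 2 :* x :* s) :+ (b :+ s :* s) :+ (x :* x :+ con 2 :* x :* s)) refl a b x s ⟩
    (a + 2 * x * s) + (b + s * s) + (x * x + 2 * x * s)
      ≡⟨ cong₂ (λ m n → m + n + (x * x + 2 * x * s)) (sum-squares-differences xs x>) (sum-squares-Δ sxs) ⟩
    (l * (x * x) + q) + l * q + (x * x + 2 * x * s)
      ≡⟨ solve 4 (λ l x q s → (l :* (x :* x) :+ q) :+ l :* q :+ (x :* x :+ con 2 :* x :* s)
           := (con 1 :+ l) :* (x :* x :+ q) :+ con 2 :* x :* s) refl l x q s ⟩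
    suc l * (x * x + q) + 2 * x * s ∎)
    where
    open ≡-Reasoning
    open +-*-Solver
    a b l q s : ℕ
    a = sum-squares (map (x ∸_) xs)
    b = sum-squares (Δ xs)
    l = length xs
    q = sum-squares xs
    s = sum xs

  sum-beta : ∀ ps → sum (beta ps) ≡ sum ps + sum (downFrom (length ps))
  sum-beta []       = refl
  sum-beta (p ∷ ps) = trans (cong (λ s → p + length ps + s) (sum-beta ps))
    (solve 4 (λ p l a b → p :+ l :+ (a :+ b) := p :+ a :+ (l :+ b)) refl p (length ps) (sum ps) _)
    where open +-*-Solver

  -- The numerators of the sum in the size formula: below row i of `t` rows there are t - i others,
  -- so `length ps + 1` is t + 1 - i.
  weighted-sum : List ℕ → ℕ
  weighted-sum []       = 0
  weighted-sum (p ∷ ps) = (p ^ 2 + 2 * (length ps + 1) * p) + weighted-sum ps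

  -- Row by row, (p + l)² + 2 p = l² + p² + 2 (l + 1) p with `l` the number of rows below. This is
  -- the origin of the coefficient t + 1 - i.
  sum-squares-beta : ∀ ps → sum-squares (beta ps) + 2 * sum ps ≡ sum-squares (downFrom (length ps)) + weighted-sum ps
  sum-squares-beta []       = refl
  sum-squares-beta (p ∷ ps) = begin
    (p + l) * (p + l) + sum-squares (beta ps) + 2 * (p + sum ps)
      ≡⟨ solve 4 (λ p l a b → (p :+ l) :* (p :+ l) :+ a :+ con 2 :* (p :+ b) := (p :+ l) :* (p :+ l) :+ con 2 :* p :+ (a :+ con 2 :* b)) refl p l (sum-squares (beta ps)) (sum ps) ⟩
    (p + l) * (p + l) + 2 * p + (sum-squares (beta ps) + 2 * sum ps)
      ≡⟨ cong (λ s → (p + l) * (p + l) + 2 * p + s) (sum-squares-beta ps) ⟩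
    (p + l) * (p + l) + 2 * p + (sum-squares (downFrom l) + weighted-sum ps)
      ≡⟨ solve 4 (λ p l a b → (p :+ l) :* (p :+ l) :+ con 2 :* p :+ (a :+ b) := l :* l :+ a :+ (p :^ 2 :+ con 2 :* (l :+ con 1) :* p :+ b)) refl p l (sum-squares (downFrom l)) (weighted-sum ps) ⟩
    l * l + sum-squares (downFrom l) + (p ^ 2 + 2 * (l + 1) * p + weighted-sum ps) ∎
    where
    open ≡-Reasoning
    open +-*-Solver
    l : ℕ
    l = length ps

  2*sum-downFrom : ∀ n → 2 * sum (downFrom n) + n ≡ n * n
  2*sum-downFrom zero    = refl
  2*sum-downFrom (suc n) = begin
    2 * (n + s) + suc n            ≡⟨ solve 2 (λ n s → con 2 :* (n :+ s) :+ (con 1 :+ n) := con 2 :* s :+ n :+ (con 2 :* n :+ con 1)) refl n s ⟩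
    2 * s + n + (2 * n + 1)        ≡⟨ cong (_+ (2 * n + 1)) (2*sum-downFrom n) ⟩
    n * n + (2 * n + 1)            ≡⟨ solve 1 (λ n → n :* n :+ (con 2 :* n :+ con 1) := (con 1 :+ n) :* (con 1 :+ n)) refl n ⟩
    suc n * suc n                  ∎
    where
    open ≡-Reasoning
    open +-*-Solver
    s : ℕ
    s = sum (downFrom n)

  -- The case of `n` zero rows in `hooks-complement`: they have no hooks.
  Δ-downFrom : ∀ n → Δ (downFrom n) ↭ intervals (downFrom n)
  Δ-downFrom n = subst (λ xs → Δ xs ↭ intervals xs) (beta-zeros n)
    (subst (λ hs → hs ++ Δ (beta (replicate n 0)) ↭ intervals (beta (replicate n 0))) (hooks-zeros (zeros≤ n)) (hooks-complement (zeros-decreasing n)))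
    where
    zeros≤ : ∀ n → All (_≤ 0) (replicate n 0)
    zeros≤ zero    = []
    zeros≤ (suc n) = z≤n ∷ zeros≤ n
    zeros-decreasing : ∀ n → WeaklyDecreasing (replicate n 0)
    zeros-decreasing zero    = []
    zeros-decreasing (suc n) = zeros≤ n ∷ zeros-decreasing n
    beta-zeros : ∀ n → beta (replicate n 0) ≡ downFrom n
    beta-zeros zero    = refl
    beta-zeros (suc n) = cong₂ _∷_ (length-replicate n) (beta-zeros n)

  downFrom-decreasing : ∀ n → StrictlyDecreasing (downFrom n)
  downFrom-decreasing n = AllPairsP.applyDownFrom⁺₁ id n λ j<i _ → j<i

  length-hooks : ∀ ps → length (hooks ps) ≡ sum ps
  length-hooks []       = refl
  length-hooks (p ∷ ps) = trans (length-++ (rowHooks p ps))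
    (cong₂ _+_ (trans (length-map _ [1… p ]) (length-applyUpTo suc p)) (length-hooks ps))

  sum-strip : ∀ {ps} → WeaklyDecreasing ps → sum (strip ps) ≡ sum ps
  sum-strip []                      = refl
  sum-strip {zero  ∷ ps} (p≥ ∷ _)   = sym (sum-zeros p≥)
    where
    sum-zeros : ∀ {ps} → All (_≤ 0) ps → sum ps ≡ 0
    sum-zeros []          = refl
    sum-zeros (z≤n ∷ p≤0) = sum-zeros p≤0
  sum-strip {suc p ∷ ps} (_ ∷ wps)  = cong (λ s → suc p + s) (sum-strip wps)

  -- From (t + x)² + (x - t)² = 2 t² + 2 x²: each hook of λ contributes 2 t² beyond twice its
  -- square, which is how |λ| enters the size formula.
  sum-squares-near-far : ∀ t xs → sum-squares (map (t +_) xs) + sum-squares (map ∣_- t ∣ xs)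
                                ≡ 2 * t ^ 2 * length xs + (sum-squares xs + sum-squares xs)
  sum-squares-near-far t []       = sym (trans (+-identityʳ _) (*-zeroʳ (2 * t ^ 2)))
  sum-squares-near-far t (x ∷ xs) = begin
    (t + x) * (t + x) + a + (∣ x - t ∣ * ∣ x - t ∣ + b)
      ≡⟨ solve 4 (λ p q a b → p :+ a :+ (q :+ b) := p :+ q :+ (a :+ b)) refl ((t + x) * (t + x)) (∣ x - t ∣ * ∣ x - t ∣) a b ⟩
    (t + x) * (t + x) + ∣ x - t ∣ * ∣ x - t ∣ + (a + b)
      ≡⟨ cong₂ _+_ pointwise (sum-squares-near-far t xs) ⟩
    2 * (t * t) + 2 * (x * x) + (2 * t ^ 2 * l + (q + q))
      ≡⟨ solve 4 (λ t x l q → con 2 :* (t :* t) :+ con 2 :* (x :* x) :+ (con 2 :* t :^ 2 :* l :+ (q :+ q))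
           := con 2 :* t :^ 2 :* (con 1 :+ l) :+ ((x :* x :+ q) :+ (x :* x :+ q))) refl t x l q ⟩
    2 * t ^ 2 * suc l + ((x * x + q) + (x * x + q)) ∎
    where
    open ≡-Reasoning
    open +-*-Solver
    a b l q : ℕ
    a = sum-squares (map (t +_) xs)
    b = sum-squares (map ∣_- t ∣ xs)
    l = length xs
    q = sum-squares xs
    pointwise : (t + x) * (t + x) + ∣ x - t ∣ * ∣ x - t ∣ ≡ 2 * (t * t) + 2 * (x * x)
    pointwise with ≤-total t x
    ... | inj₁ t≤x with x ∸ t | m+[n∸m]≡n t≤x
    ...   | y | refl = trans (cong (λ d → (t + (t + y)) * (t + (t + y)) + d * d) (trans (∣-∣-comm (t + y) t) (∣m-m+n∣≡n t y)))
            (solve 2 (λ t y → (t :+ (t :+ y)) :* (t :+ (t :+ y)) :+ y :* y := con 2 :* (t :* t) :+ con 2 :* ((t :+ y) :* (t :+ y))) refl t y)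
    pointwise | inj₂ x≤t with t ∸ x | m+[n∸m]≡n x≤t
    ...   | y | refl = trans (cong (λ d → (x + y + x) * (x + y + x) + d * d) (∣m-m+n∣≡n x y))
            (solve 2 (λ x y → (x :+ y :+ x) :* (x :+ y :+ x) :+ y :* y := con 2 :* ((x :+ y) :* (x :+ y)) :+ con 2 :* (x :* x)) refl x y)

  weighted-sum-parts : ∀ {t} μ qs → length qs ≡ t → (∀ {i} → i < t → part μ (suc i) ≡ nth qs i) →
    weighted-sum qs ≡ sum (map (λ i → part μ i ^ 2 + 2 * (t + 1 ∸ i) * part μ i) [1… t ])
  weighted-sum-parts {t} μ qs refl part≡ = trans (rows qs) (cong sum (trans
    (applyUpTo-cong t λ {i} i<t → cong (λ p → p ^ 2 + 2 * (t + 1 ∸ suc i) * p) (sym (part≡ i<t)))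
    (sym (map-applyUpTo suc (λ i → part μ i ^ 2 + 2 * (t + 1 ∸ i) * part μ i) t))))
    where
    rows : ∀ qs → weighted-sum qs ≡ sum (applyUpTo (λ i → nth qs i ^ 2 + 2 * (length qs + 1 ∸ suc i) * nth qs i) (length qs))
    rows []       = refl
    rows (q ∷ qs) = cong (λ s → (q ^ 2 + 2 * (length qs + 1) * q) + s) (rows qs)

  -- Squaring in `hook-multiset` cancels the hooks of λ up to 2 t² per box and leaves `C` minus `H`,
  -- which `hooks-contents` converts into `D₁` minus `D₀`. The variance identity evaluates both, and
  -- `E₃` brings in the weighted sum.
  size-identity : ∀ t .{{_ : NonZero t}} (κ : Core t) →
    let ν = value κ; A = size (quotient t ν) in
    size ν * (2 * t ^ 2) + A * (A + t + t ^ 2) ≡ t * weighted-sum (quotientRows t (parts ν))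
  size-identity t κ = +-cancelʳ-≡ (t * Q₀) _ _ (begin
    L * (2 * t ^ 2) + size (quotient t ν) * (size (quotient t ν) + t + t ^ 2) + t * Q₀
      ≡⟨ cong (λ a → L * (2 * t ^ 2) + a * (a + t + t ^ 2) + t * Q₀) (sum-strip wqs) ⟩
    L * (2 * t ^ 2) + A * (A + t + t ^ 2) + t * Q₀
      ≡⟨ cong (λ m → L * (2 * t ^ 2) + A * (A + t + t ^ 2) + m) E₁ ⟨
    L * (2 * t ^ 2) + A * (A + t + t ^ 2) + (D₀ + P * P)
      ≡⟨ solve 5 (λ L t A D P → L :* (con 2 :* t :^ 2) :+ A :* (A :+ t :+ t :^ 2) :+ (D :+ P :* P)
           := (con 2 :* t :^ 2 :* L :+ D) :+ (P :* P :+ A :* A :+ A :* t :+ A :* (t :* t))) refl L t A D₀ P ⟩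
    2 * t ^ 2 * L + D₀ + (P * P + A * A + A * t + A * (t * t))
      -- Here t² is replaced by 2 P + t, so that the square (A + P)² required by the variance
      -- identity can be completed.
      ≡⟨ cong₂ (λ m n → m + (P * P + A * A + A * t + A * n)) E₄ (sym (2*sum-downFrom t)) ⟩
    D₁ + (P * P + A * A + A * t + A * (2 * P + t))
      ≡⟨ solve 4 (λ D P A t → D :+ (P :* P :+ A :* A :+ A :* t :+ A :* (con 2 :* P :+ t))
           := D :+ (A :+ P) :* (A :+ P) :+ t :* (con 2 :* A)) refl D₁ P A t ⟩
    D₁ + (A + P) * (A + P) + t * (2 * A)
      ≡⟨ cong (_+ t * (2 * A)) E₂ ⟩
    t * sum-squares vs + t * (2 * A)
      ≡⟨ *-distribˡ-+ t (sum-squares vs) (2 * A) ⟨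
    t * (sum-squares vs + 2 * A)
      ≡⟨ cong (t *_) E₃ ⟩
    t * (Q₀ + S)
      ≡⟨ solve 3 (λ t q s → t :* (q :+ s) := t :* s :+ t :* q) refl t Q₀ S ⟩
    t * S + t * Q₀ ∎)
    where
    open ≡-Reasoning
    open +-*-Solver
    ν : Partition
    ν = value κ
    open Core↦Complete (parts-decreasing ν) (core-hooks κ) hiding (module S)
    L A S P Q₀ D₀ D₁ H C : ℕ
    L  = size ν
    A  = sum qs
    S  = weighted-sum qs
    P  = sum (downFrom t)
    Q₀ = sum-squares (downFrom t)
    D₀ = sum-squares (Δ (downFrom t))
    D₁ = sum-squares (Δ vs)
    H  = sum-squares (hooks qs)
    C  = sum-squares (contents t qs)
    E₁ : D₀ + P * P ≡ t * Q₀
    E₁ = trans (sum-squares-Δ (downFrom-decreasing t)) (cong (_* Q₀) (length-downFrom t))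
    sum-vs : sum vs ≡ A + P
    sum-vs = trans (cong sum (sym beta-qs)) (trans (sum-beta qs) (cong (λ n → A + sum (downFrom n)) length-qs))
    E₂ : D₁ + (A + P) * (A + P) ≡ t * sum-squares vs
    E₂ = trans (cong (λ s → D₁ + s * s) (sym sum-vs)) (trans (sum-squares-Δ svs) (cong (_* sum-squares vs) length-vs))
    E₃ : sum-squares vs + 2 * A ≡ Q₀ + S
    E₃ = trans (cong (λ xs → sum-squares xs + 2 * A) (sym beta-qs))
      (trans (sum-squares-beta qs) (cong (λ n → sum-squares (downFrom n) + S) length-qs))
    H+D₁ : H + D₁ ≡ C + D₀
    H+D₁ = trans (sym (sum-squares-++ (hooks qs) _)) (trans (sum-squares-↭ hooks-contents)
      (trans (sum-squares-++ (contents t qs) _) (cong (C +_) (sym (sum-squares-↭ (Δ-downFrom t))))))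
    N F : ℕ
    N = sum-squares (map ∣_- t ∣ (hooks (parts ν)))
    F = sum-squares (map (t +_) (hooks (parts ν)))
    G : ℕ
    G = sum-squares (hooks (parts ν))
    total : F + (N + H) ≡ C + (G + G)
    total = trans (sym (++₃ (map (t +_) (hooks (parts ν))) _ (hooks qs))) (trans (sum-squares-↭ hook-multiset) (++₃ (contents t qs) (hooks (parts ν)) (hooks (parts ν))))
      where
      ++₃ : ∀ as bs cs → sum-squares (as ++ bs ++ cs) ≡ sum-squares as + (sum-squares bs + sum-squares cs)
      ++₃ as bs cs = trans (sum-squares-++ as _) (cong (λ s → sum-squares as + s) (sum-squares-++ bs cs))
    E₄ : 2 * t ^ 2 * L + D₀ ≡ D₁
    E₄ = +-cancelʳ-≡ (C + (G + G)) _ _ (begin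
      2 * t ^ 2 * L + D₀ + (C + (G + G))
        ≡⟨ solve 4 (λ l d c g → l :+ d :+ (c :+ g) := (l :+ g) :+ (c :+ d)) refl (2 * t ^ 2 * L) D₀ C (G + G) ⟩
      2 * t ^ 2 * L + (G + G) + (C + D₀)
        ≡⟨ cong₂ _+_ (trans (sum-squares-near-far t (hooks (parts ν))) (cong (λ l → 2 * t ^ 2 * l + (G + G)) (length-hooks (parts ν)))) H+D₁ ⟨
      F + N + (H + D₁)
        ≡⟨ solve 4 (λ f n h d → f :+ n :+ (h :+ d) := d :+ (f :+ (n :+ h))) refl F N H D₁ ⟩
      D₁ + (F + (N + H))
        ≡⟨ cong (D₁ +_) total ⟩
      D₁ + (C + (G + G)) ∎)

  -- From natural numbers to rational numbers

  /-+ : ∀ a b n .{{_ : NonZero n}} → (ℤ.+ a ℚ./ n) ℚ.+ (ℤ.+ b ℚ./ n) ≡ ℤ.+ (a + b) ℚ./ n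
  /-+ a b (suc n) = ℚP.toℚᵘ-injective (begin
    ℚ.toℚᵘ (ℤ.+ a ℚ./ suc n ℚ.+ ℤ.+ b ℚ./ suc n)                  ≈⟨ ℚP.toℚᵘ-homo-+ (ℤ.+ a ℚ./ suc n) (ℤ.+ b ℚ./ suc n) ⟩
    ℚ.toℚᵘ (ℤ.+ a ℚ./ suc n) ℚᵘ.+ ℚ.toℚᵘ (ℤ.+ b ℚ./ suc n)        ≈⟨ ℚᵘP.+-cong (ℚP.toℚᵘ-fromℚᵘ (mkℚᵘ (ℤ.+ a) n)) (ℚP.toℚᵘ-fromℚᵘ (mkℚᵘ (ℤ.+ b) n)) ⟩
    mkℚᵘ (ℤ.+ a) n ℚᵘ.+ mkℚᵘ (ℤ.+ b) n                            ≈⟨ *≡* (solve 3 (λ a b n → (a :* n :+ b :* n) :* n := (a :+ b) :* (n :* n)) refl (ℤ.+ a) (ℤ.+ b) (ℤ.+ suc n)) ⟩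
    mkℚᵘ (ℤ.+ (a + b)) n                                        ≈⟨ ℚP.toℚᵘ-fromℚᵘ (mkℚᵘ (ℤ.+ (a + b)) n) ⟨
    ℚ.toℚᵘ (ℤ.+ (a + b) ℚ./ suc n)                              ∎)
    where
    open ℚᵘP.≃-Reasoning
    open ℤS.+-*-Solver

  ∑-/ : ∀ is (g : ℕ → ℕ) n .{{_ : NonZero n}} → ∑ is (λ i → ℤ.+ g i ℚ./ n) ≡ ℤ.+ sum (map g is) ℚ./ n
  ∑-/ []       g n@(suc _) = sym (ℚP.0/n≡0 n)
  ∑-/ (i ∷ is) g n = trans (cong (λ q → ℤ.+ g i ℚ./ n ℚ.+ q) (∑-/ is g n)) (/-+ (g i) (sum (map g is)) n)

  -- Divides the identity by `d`, the last term having the smaller denominator `e` because d = t e.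
  -- Unnormalised rationals reduce the claim to a cross multiplication in ℤ.
  rational-form : ∀ L A B S t d e .{{_ : NonZero d}} .{{_ : NonZero e}} → d ≡ t * e → L * d + A * B ≡ t * S →
    ℤ.+ L ℚ./ 1 ≡ (ℚ.- (ℤ.+ A ℚ./ 1)) ℚ.* (ℤ.+ B ℚ./ d) ℚ.+ ℤ.+ S ℚ./ e
  rational-form L A B S t d@(suc d′) e@(suc e′) d≡ eq = ℚP.toℚᵘ-injective (begin
    ℚ.toℚᵘ (ℤ.+ L ℚ./ 1)                                        ≈⟨ ℚP.toℚᵘ-fromℚᵘ (mkℚᵘ (ℤ.+ L) 0) ⟩
    mkℚᵘ (ℤ.+ L) 0                                              ≈⟨ *≡* cross ⟩
    (ℚᵘ.- mkℚᵘ (ℤ.+ A) 0) ℚᵘ.* mkℚᵘ (ℤ.+ B) d′ ℚᵘ.+ mkℚᵘ (ℤ.+ S) e′ ≈⟨ ℚᵘP.+-cong (ℚᵘP.*-cong (ℚᵘP.-‿cong (ℚP.toℚᵘ-fromℚᵘ (mkℚᵘ (ℤ.+ A) 0))) (ℚP.toℚᵘ-fromℚᵘ (mkℚᵘ (ℤ.+ B) d′))) (ℚP.toℚᵘ-fromℚᵘ (mkℚᵘ (ℤ.+ S) e′)) ⟨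
    (ℚᵘ.- ℚ.toℚᵘ (ℤ.+ A ℚ./ 1)) ℚᵘ.* ℚ.toℚᵘ (ℤ.+ B ℚ./ d) ℚᵘ.+ ℚ.toℚᵘ (ℤ.+ S ℚ./ e)
                                                              ≈⟨ ℚᵘP.+-congˡ _ (ℚᵘP.*-congʳ (ℚP.toℚᵘ-homo‿- (ℤ.+ A ℚ./ 1))) ⟨
    ℚ.toℚᵘ (ℚ.- (ℤ.+ A ℚ./ 1)) ℚᵘ.* ℚ.toℚᵘ (ℤ.+ B ℚ./ d) ℚᵘ.+ ℚ.toℚᵘ (ℤ.+ S ℚ./ e)
                                                              ≈⟨ ℚᵘP.+-congˡ _ (ℚP.toℚᵘ-homo-* (ℚ.- (ℤ.+ A ℚ./ 1)) (ℤ.+ B ℚ./ d)) ⟨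
    ℚ.toℚᵘ (ℚ.- (ℤ.+ A ℚ./ 1) ℚ.* (ℤ.+ B ℚ./ d)) ℚᵘ.+ ℚ.toℚᵘ (ℤ.+ S ℚ./ e)
                                                              ≈⟨ ℚP.toℚᵘ-homo-+ (ℚ.- (ℤ.+ A ℚ./ 1) ℚ.* (ℤ.+ B ℚ./ d)) (ℤ.+ S ℚ./ e) ⟨
    ℚ.toℚᵘ (ℚ.- (ℤ.+ A ℚ./ 1) ℚ.* (ℤ.+ B ℚ./ d) ℚ.+ ℤ.+ S ℚ./ e)    ∎)
    where
    open ℚᵘP.≃-Reasoning
    eqℤ : ℤ.+ L ℤ.* ℤ.+ d ℤ.+ ℤ.+ A ℤ.* ℤ.+ B ≡ ℤ.+ t ℤ.* ℤ.+ S
    eqℤ = trans (sym (trans (ℤP.pos-+ (L * d) (A * B)) (cong₂ ℤ._+_ (ℤP.pos-* L d) (ℤP.pos-* A B))))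
      (trans (cong ℤ.+_ eq) (ℤP.pos-* t S))
    dℤ : ℤ.+ d ≡ ℤ.+ t ℤ.* ℤ.+ e
    dℤ = trans (cong ℤ.+_ d≡) (ℤP.pos-* t e)
    cross : ℤ.+ L ℤ.* ℤ.+ (1 * d * e) ≡ ((ℤ.- ℤ.+ A ℤ.* ℤ.+ B) ℤ.* ℤ.+ e ℤ.+ ℤ.+ S ℤ.* ℤ.+ (1 * d)) ℤ.* ℤ.+ 1
    cross = ≡-Reasoning.begin
      ℤ.+ L ℤ.* ℤ.+ (1 * d * e)
        ≡-Reasoning.≡⟨ cong (ℤ.+ L ℤ.*_) (trans (cong (λ n → ℤ.+ (n * e)) (*-identityˡ d)) (ℤP.pos-* d e)) ⟩
      ℤ.+ L ℤ.* (ℤ.+ d ℤ.* ℤ.+ e)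
        ≡-Reasoning.≡⟨ solve 5 (λ L d e A B → L :* (d :* e) := (L :* d :+ A :* B) :* e :- A :* B :* e) refl (ℤ.+ L) (ℤ.+ d) (ℤ.+ e) (ℤ.+ A) (ℤ.+ B) ⟩
      (ℤ.+ L ℤ.* ℤ.+ d ℤ.+ ℤ.+ A ℤ.* ℤ.+ B) ℤ.* ℤ.+ e ℤ.- ℤ.+ A ℤ.* ℤ.+ B ℤ.* ℤ.+ e
        ≡-Reasoning.≡⟨ cong (λ m → m ℤ.* ℤ.+ e ℤ.- ℤ.+ A ℤ.* ℤ.+ B ℤ.* ℤ.+ e) eqℤ ⟩
      ℤ.+ t ℤ.* ℤ.+ S ℤ.* ℤ.+ e ℤ.- ℤ.+ A ℤ.* ℤ.+ B ℤ.* ℤ.+ e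
        ≡-Reasoning.≡⟨ solve 5 (λ t S e A B → t :* S :* e :- A :* B :* e := ((:- A) :* B :* e :+ S :* (t :* e)) :* con (ℤ.+ 1)) refl (ℤ.+ t) (ℤ.+ S) (ℤ.+ e) (ℤ.+ A) (ℤ.+ B) ⟩
      ((ℤ.- ℤ.+ A ℤ.* ℤ.+ B) ℤ.* ℤ.+ e ℤ.+ ℤ.+ S ℤ.* (ℤ.+ t ℤ.* ℤ.+ e)) ℤ.* ℤ.+ 1
        ≡-Reasoning.≡⟨ cong (λ m → ((ℤ.- ℤ.+ A ℤ.* ℤ.+ B) ℤ.* ℤ.+ e ℤ.+ ℤ.+ S ℤ.* m) ℤ.* ℤ.+ 1) (trans (sym dℤ) (cong ℤ.+_ (sym (*-identityˡ d)))) ⟩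
      ((ℤ.- ℤ.+ A ℤ.* ℤ.+ B) ℤ.* ℤ.+ e ℤ.+ ℤ.+ S ℤ.* ℤ.+ (1 * d)) ℤ.* ℤ.+ 1 ≡-Reasoning.∎
      where open ℤS.+-*-Solver

  size-formula : ∀ t .{{_ : NonZero t}} (κ : Core t) →
    let ν = value κ; μ = quotient t ν in
    ℤ.+ size ν ℚ./ 1
      ≡ (ℚ.- (ℤ.+ size μ ℚ./ 1)) ℚ.* ℚ._/_ (ℤ.+ (size μ + t + t ^ 2)) (2 * t ^ 2) {{m*n≢0 2 (t ^ 2) {{_}} {{m^n≢0 t 2}}}}
        ℚ.+ ∑ [1… t ] λ i → ℚ._/_ (ℤ.+ (part μ i ^ 2 + 2 * (t + 1 ∸ i) * part μ i)) (2 * t) {{m*n≢0 2 t}}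
  size-formula t κ = trans
    (rational-form (size ν) (size μ) (size μ + t + t ^ 2) _ t (2 * t ^ 2) (2 * t) {{m*n≢0 2 (t ^ 2) {{_}} {{m^n≢0 t 2}}}} {{m*n≢0 2 t}}
      (solve 1 (λ t → con 2 :* t :^ 2 := t :* (con 2 :* t)) refl t)
      (trans (size-identity t κ) (cong (t *_) (weighted-sum-parts μ qs length-qs λ {i} _ → part-quotient t ν i))))
    (cong (λ s → (ℚ.- (ℤ.+ size μ ℚ./ 1)) ℚ.* ℚ._/_ (ℤ.+ (size μ + t + t ^ 2)) (2 * t ^ 2) {{m*n≢0 2 (t ^ 2) {{_}} {{m^n≢0 t 2}}}} ℚ.+ s)
      (sym (∑-/ [1… t ] (λ i → part μ i ^ 2 + 2 * (t + 1 ∸ i) * part μ i) (2 * t) {{m*n≢0 2 t}})))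
    where
    open +-*-Solver
    ν μ : Partition
    ν = value κ
    μ = quotient t ν
    open Core↦Complete (parts-decreasing ν) (core-hooks κ) using (qs; length-qs)

open Combinatorics
open import Defs
open import Level using (Level)
open import Algebra.Apartness.Bundles using (HeytingField; HeytingCommutativeRing)
open import Algebra.Bundles using (CommutativeRing)
open import Data.Empty using (⊥-elim)
open import Data.Integer.Base as ℤ using (ℤ; +_)
import Data.Integer.Properties as ℤ
open import Data.List.Base using (List; []; _∷_; _++_; foldr; map; length; filter; concat; concatMap; applyUpTo)
open import Data.List.Membership.Propositional using (_∈_)
open import Data.List.Properties using (map-∘; map-++; map-cong; map-applyUpTo; filter-accept; filter-reject)
open import Data.List.Relation.Binary.Permutation.Propositional as Perm using (_↭_; prep; swap)
open import Data.List.Relation.Unary.All as All using (All; []; _∷_)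
import Data.List.Relation.Unary.All.Properties as All
open import Data.List.Relation.Unary.AllPairs using (AllPairs; []; _∷_)
import Data.List.Relation.Unary.AllPairs.Properties as AllPairs
open import Data.List.Relation.Unary.Any using (here; there)
open import Data.List.Membership.Propositional.Properties using (∈-applyUpTo⁺)
open import Data.Nat.Base as ℕ using (ℕ; zero; suc; pred; NonZero; _∸_; _≤_; _<_; z≤n; s≤s; ∣_-_∣)
import Data.Nat.Properties as ℕ
open import Data.Nat.Divisibility using (∣-refl)
open import Data.Product.Base using (_×_; _,_; proj₁; proj₂)
open import Data.Refinement.Base using (value)
open import Data.Sum.Base using (inj₁; inj₂)
open import Function.Base using (_∘_)
open import Relation.Binary.PropositionalEquality as ≡ using (_≡_; _≢_)
open import Relation.Nullary using (yes; no)
open import Data.Nat.Properties using (m*n≢0; m^n≢0)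
open import Data.Rational.Base as ℚ using (_/_)
open import Function.Bundles using (_⤖_; module Bijection)

-- The product formula

-- Every row index i is at most `t`, so t + (j - i) is the natural number (t - i) + j.
map-contents : ∀ {t} μ → len μ ≤ t → map (λ □ → + t ℤ.+ content □) (boxes μ) ≡ map +_ (contents t (parts μ))
map-contents {t} μ len≤t = ≡.trans (map-concat-applyUpTo (λ □ → + t ℤ.+ content □) _ (len μ))
  (≡.trans (≡.cong concat (applyUpTo-cong (len μ) λ {i} i< → row i (ℕ.<-≤-trans i< len≤t) [1… part μ (suc i) ])) (rows t (parts μ)))
  where
  entry : ∀ i j → i ≤ t → + t ℤ.+ (+ j ℤ.- + i) ≡ + (t ∸ i ℕ.+ j)
  entry i j i≤t = begin
    + t ℤ.+ (+ j ℤ.- + i)        ≡⟨ ≡.cong (λ z → + t ℤ.+ z) (ℤ.+-comm (+ j) (ℤ.- + i)) ⟩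
    + t ℤ.+ (ℤ.- + i ℤ.+ + j)    ≡⟨ ℤ.+-assoc (+ t) (ℤ.- + i) (+ j) ⟨
    + t ℤ.- + i ℤ.+ + j          ≡⟨ ≡.cong (λ z → z ℤ.+ + j) (≡.trans (ℤ.m-n≡m⊖n t i) (ℤ.⊖-≥ i≤t)) ⟩
    + (t ∸ i ℕ.+ j)              ∎
    where open ≡.≡-Reasoning
  row : ∀ i → i < t → ∀ js → map (λ □ → + t ℤ.+ content □) (map (suc i ,_) js) ≡ map +_ (map (λ j → t ∸ suc i ℕ.+ j) js)
  row i i<t js = ≡.trans (≡.sym (map-∘ js)) (≡.trans (map-cong (λ j → entry (suc i) j i<t) js) (map-∘ js))
  pred∸ : ∀ n i → n ∸ suc i ≡ pred n ∸ i
  pred∸ zero    i = ≡.sym (ℕ.0∸n≡0 i)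
  pred∸ (suc n) i = ≡.refl
  rows : ∀ n ps → concat (applyUpTo (λ i → map +_ (map (λ j → n ∸ suc i ℕ.+ j) [1… nth ps i ])) (length ps)) ≡ map +_ (contents n ps)
  rows n []       = ≡.refl
  rows n (p ∷ ps) = ≡.trans (≡.cong₂ _++_
      (≡.cong (λ m → map +_ (map (λ j → m ℕ.+ j) [1… p ])) (pred∸ n 0))
      (≡.trans (≡.cong concat (applyUpTo-cong (length ps) λ {i} _ → ≡.cong (λ m → map +_ (map (λ j → m ℕ.+ j) [1… nth ps i ])) (pred∸ n (suc i)))) (rows (pred n) ps)))
    (≡.sym (map-++ +_ (map (λ j → pred n ℕ.+ j) [1… p ]) _))

length-filter-≟ : ∀ {a} {A : Set a} (f : A → ℕ) k xs → length (filter (λ x → f x ℕ.≟ k) xs) ≡ count k (map f xs)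
length-filter-≟ f k []       = ≡.refl
length-filter-≟ f k (x ∷ xs) with f x ℕ.≟ k
... | yes fx≡k = ≡.trans (≡.cong length (filter-accept (λ x → f x ℕ.≟ k) fx≡k))
  (≡.cong₂ ℕ._+_ (≡.sym (≡.trans (≡.cong (δ k) fx≡k) (δ-refl k))) (length-filter-≟ f k xs))
... | no  fx≢k = ≡.trans (≡.cong length (filter-reject (λ x → f x ℕ.≟ k) fx≢k))
  (≡.cong₂ ℕ._+_ (≡.sym (δ-≢ (fx≢k ∘ ≡.sym))) (length-filter-≟ f k xs))

module Products {c ℓ₁ ℓ₂ : Level} (F : HeytingField c ℓ₁ ℓ₂) where

  open FieldOps F
  open HeytingCommutativeRing heytingCommutativeRing using (commutativeRing)
  open CommutativeRing commutativeRing
    using (setoid; refl; sym; trans; reflexive; *-cong; *-congˡ; *-congʳ; *-assoc; *-comm; *-identityˡ; *-identityʳ; *-commutativeMonoid; semiring)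
  open import Algebra.Apartness.Properties.HeytingCommutativeRing heytingCommutativeRing using (x-0≈x; 1#0; x#0y#0→xy#0)
  open import Algebra.Properties.Semiring.Exp semiring using (^-homo-*)
  open import Algebra.Solver.CommutativeMonoid *-commutativeMonoid using (solve; _⊕_; _⊜_)
  open import Relation.Binary.Reasoning.Setoid setoid

  Π : ∀ {a} {A : Set a} → (A → Carrier) → List A → Carrier
  Π f xs = foldr _*_ 1# (map f xs)

  *-inverse : ∀ {y} (y#0 : y # 0#) → proj₁ (#⇒invertible y#0) * y ≈ 1#
  *-inverse {y} y#0 = trans (*-congˡ (sym (x-0≈x y))) (proj₁ (proj₂ (#⇒invertible y#0)))

  ÷-* : ∀ x {y} (y#0 : y # 0#) → x ÷ y ⟨ y#0 ⟩ * y ≈ x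
  ÷-* x y#0 = trans (*-assoc x _ _) (trans (*-congˡ (*-inverse y#0)) (*-identityʳ x))

  *-cancelʳ-# : ∀ {x y z} → z # 0# → x * z ≈ y * z → x ≈ y
  *-cancelʳ-# {x} {y} {z} z#0 xz≈yz = trans (expand x) (trans (*-congʳ xz≈yz) (sym (expand y)))
    where
    expand : ∀ w → w ≈ w * z * proj₁ (#⇒invertible z#0)
    expand w = begin
      w                                       ≈⟨ *-identityʳ w ⟨
      w * 1#                                  ≈⟨ *-congˡ (*-inverse z#0) ⟨
      w * (proj₁ (#⇒invertible z#0) * z)      ≈⟨ *-congˡ (*-comm _ z) ⟩
      w * (z * proj₁ (#⇒invertible z#0))      ≈⟨ *-assoc w z _ ⟨
      w * z * proj₁ (#⇒invertible z#0)        ∎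

  interchange : ∀ w x y z → (w * x) * (y * z) ≈ (w * y) * (x * z)
  interchange = solve 4 (λ w x y z → (w ⊕ x) ⊕ (y ⊕ z) ⊜ (w ⊕ y) ⊕ (x ⊕ z)) refl

  Π-++ : ∀ {a} {A : Set a} (f : A → Carrier) xs ys → Π f (xs ++ ys) ≈ Π f xs * Π f ys
  Π-++ f []       ys = sym (*-identityˡ _)
  Π-++ f (x ∷ xs) ys = trans (*-congˡ (Π-++ f xs ys)) (sym (*-assoc _ _ _))

  Π-* : ∀ {a} {A : Set a} (f g : A → Carrier) xs → Π (λ x → f x * g x) xs ≈ Π f xs * Π g xs
  Π-* f g []       = sym (*-identityˡ 1#)
  Π-* f g (x ∷ xs) = trans (*-congˡ (Π-* f g xs)) (interchange (f x) (g x) _ _)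

  Π-cong : ∀ {a} {A : Set a} {f g : A → Carrier} → (∀ x → f x ≈ g x) → ∀ xs → Π f xs ≈ Π g xs
  Π-cong f≈g []       = refl
  Π-cong f≈g (x ∷ xs) = *-cong (f≈g x) (Π-cong f≈g xs)

  Π-map : ∀ {a b} {A : Set a} {B : Set b} (f : B → Carrier) (g : A → B) xs → Π f (map g xs) ≡ Π (f ∘ g) xs
  Π-map f g xs = ≡.cong (foldr _*_ 1#) (≡.sym (map-∘ xs))

  Π-↭ : ∀ {a} {A : Set a} (f : A → Carrier) {xs ys} → xs ↭ ys → Π f xs ≈ Π f ys
  Π-↭ f Perm.refl                      = refl
  Π-↭ f (prep x xs↭ys)                 = *-congˡ (Π-↭ f xs↭ys)
  Π-↭ f (swap {xs} {ys} x y xs↭ys)     = begin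
    f x * (f y * Π f xs)   ≈⟨ solve 3 (λ x y p → x ⊕ (y ⊕ p) ⊜ y ⊕ (x ⊕ p)) refl (f x) (f y) (Π f xs) ⟩
    f y * (f x * Π f xs)   ≈⟨ *-congˡ (*-congˡ (Π-↭ f xs↭ys)) ⟩
    f y * (f x * Π f ys)   ∎
  Π-↭ f (Perm.trans p q)               = trans (Π-↭ f p) (Π-↭ f q)

  Π-#0 : ∀ {a} {A : Set a} {f : A → Carrier} {xs} → All (λ x → f x # 0#) xs → Π f xs # 0#
  Π-#0 []             = 1#0
  Π-#0 (fx#0 ∷ fxs#0) = x#0y#0→xy#0 fx#0 (Π-#0 fxs#0)

  -- Clears the denominators of a whole product at once, after which only plain products of values
  -- of `τ` need comparing.
  ∏-÷ : ∀ {a p} {A : Set a} {P : A → Set p} {xs} (pxs : All P xs) (f g : A → Carrier) (g#0 : ∀ {x} → P x → g x # 0#) →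
        ∏ pxs (λ x px → f x ÷ g x ⟨ g#0 px ⟩) * Π g xs ≈ Π f xs
  ∏-÷ []         f g g#0 = *-identityˡ 1#
  ∏-÷ (px ∷ pxs) f g g#0 = trans (interchange _ _ _ _) (*-cong (÷-* _ (g#0 px)) (∏-÷ pxs f g g#0))

  ∏-^0 : ∀ {a p} {A : Set a} {P : A → Set p} {xs} (pxs : All P xs) (f : ∀ x → P x → Carrier) (e : A → ℕ) →
         All (λ x → e x ≡ 0) xs → ∏ pxs (λ x px → f x px ^ e x) ≈ 1#
  ∏-^0 []         f e []           = refl
  ∏-^0 (px ∷ pxs) f e (e≡0 ∷ es≡0) = trans (*-cong (reflexive (≡.cong (f _ px ^_) e≡0)) (∏-^0 pxs f e es≡0)) (*-identityˡ 1#)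

  ∏-^+ : ∀ {a p} {A : Set a} {P : A → Set p} {xs} (pxs : All P xs) (f : ∀ x → P x → Carrier) (d e : A → ℕ) →
         ∏ pxs (λ x px → f x px ^ (d x ℕ.+ e x)) ≈ ∏ pxs (λ x px → f x px ^ d x) * ∏ pxs (λ x px → f x px ^ e x)
  ∏-^+ []                f d e = sym (*-identityˡ 1#)
  ∏-^+ {xs = x ∷ _} (px ∷ pxs) f d e = trans (*-cong (^-homo-* (f x px) (d x) (e x)) (∏-^+ pxs f d e)) (interchange _ _ _ _)

  ∏-^-cong : ∀ {a p} {A : Set a} {P : A → Set p} {xs} (pxs : All P xs) (f : ∀ x → P x → Carrier) {d e : A → ℕ} →
         (∀ x → d x ≡ e x) → ∏ pxs (λ x px → f x px ^ d x) ≈ ∏ pxs (λ x px → f x px ^ e x)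
  ∏-^-cong []                       f d≡e = refl
  ∏-^-cong {xs = x ∷ _} (px ∷ pxs) f d≡e = *-cong (reflexive (≡.cong (f x px ^_) (d≡e x))) (∏-^-cong pxs f d≡e)

  module _ (τ : ℤ → Carrier) where

    reflection : ∀ i → τ (+ i) # 0# → Carrier
    reflection i τi#0 = τ (ℤ.- + i) ÷ τ (+ i) ⟨ τi#0 ⟩

    -- The exponents select the single factor τ(- j) / τ(j); the strict order ensures that `j`
    -- occurs only once.
    ∏-reflection-pick : ∀ {is j} (his : All (λ i → τ (+ i) # 0#) is) → AllPairs _<_ is → j ∈ is →
      (e : ℕ → ℕ) → e j ≡ 1 → All (λ i → i ≢ j → e i ≡ 0) is →
      ∏ his (λ i τi#0 → reflection i τi#0 ^ e i) * τ (+ j) ≈ τ (ℤ.- + j)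
    ∏-reflection-pick {j ∷ _} (hj ∷ his) (j< ∷ _) (here ≡.refl) e ej≡1 (_ ∷ e≡0) = begin
      reflection j hj ^ e j * ∏ his (λ i τi#0 → reflection i τi#0 ^ e i) * τ (+ j)
        ≈⟨ *-congʳ (*-cong (reflexive (≡.cong (reflection j hj ^_) ej≡1)) (∏-^0 his reflection e (All.zipWith (λ (ei , j<i) → ei (ℕ.>⇒≢ j<i)) (e≡0 , j<)))) ⟩
      reflection j hj * 1# * 1# * τ (+ j)
        ≈⟨ *-congʳ (trans (*-identityʳ _) (*-identityʳ _)) ⟩
      reflection j hj * τ (+ j)
        ≈⟨ ÷-* (τ (ℤ.- + j)) hj ⟩
      τ (ℤ.- + j) ∎
    ∏-reflection-pick {i ∷ _} {j} (hi ∷ his) (i< ∷ <is) (there j∈) e ej≡1 (ei≡0 ∷ e≡0) = begin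
      reflection i hi ^ e i * ∏ his (λ i τi#0 → reflection i τi#0 ^ e i) * τ (+ j)
        ≈⟨ *-congʳ (*-congʳ (reflexive (≡.cong (reflection i hi ^_) (ei≡0 (ℕ.<⇒≢ (All.lookup i< j∈)))))) ⟩
      1# * ∏ his (λ i τi#0 → reflection i τi#0 ^ e i) * τ (+ j)
        ≈⟨ *-congʳ (*-identityˡ _) ⟩
      ∏ his (λ i τi#0 → reflection i τi#0 ^ e i) * τ (+ j)
        ≈⟨ ∏-reflection-pick his <is j∈ e ej≡1 e≡0 ⟩
      τ (ℤ.- + j) ∎

    module _ {t : ℕ} (hτ : All (λ i → τ (+ i) # 0#) [1… t ∸ 1 ]) where

      ≤t : All (_≤ t) [1… t ∸ 1 ]
      ≤t = All.applyUpTo⁺₁ suc (t ∸ 1) λ i<t-1 → ℕ.≤-trans i<t-1 (ℕ.m∸n≤m t 1)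

      -- If h < t, then h - t = - i for i = t - h, and the only nontrivial factor τ(- i) / τ(i)
      -- corrects the sign lost in |h - t|. If h ≥ t, no sign is lost, and all exponents are 0
      -- because every t - i lies below `t`.
      reflect : ∀ {h} → 0 < h → h ≢ t →
        ∏ hτ (λ i τi#0 → reflection i τi#0 ^ δ (t ∸ i) h) * τ (+ ∣ h - t ∣) ≈ τ (+ h ℤ.- + t)
      reflect {h} 0<h h≢t with ≤∨+ t h
      ... | inj₂ (y , ≡.refl) = begin
        ∏ hτ (λ i τi#0 → reflection i τi#0 ^ δ (t ∸ i) (t ℕ.+ y)) * τ (+ ∣ t ℕ.+ y - t ∣)
          ≈⟨ *-congʳ (∏-^0 hτ reflection (λ i → δ (t ∸ i) (t ℕ.+ y)) (All.applyUpTo⁺₁ suc (t ∸ 1) λ {i} i< → δ-≢ (ℕ.<⇒≢ (lt i i<)))) ⟩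
        1# * τ (+ ∣ t ℕ.+ y - t ∣)
          ≈⟨ *-identityˡ _ ⟩
        τ (+ ∣ t ℕ.+ y - t ∣)
          ≡⟨ ≡.cong τ (≡.trans (≡.cong +_ (≡.trans (ℕ.∣-∣-comm (t ℕ.+ y) t) (ℕ.∣m-m+n∣≡n t y))) (≡.sym +y)) ⟩
        τ (+ (t ℕ.+ y) ℤ.- + t) ∎
        where
        +y : + (t ℕ.+ y) ℤ.- + t ≡ + y
        +y = ≡.trans (ℤ.m-n≡m⊖n (t ℕ.+ y) t) (≡.trans (ℤ.⊖-≥ (ℕ.m≤m+n t y)) (≡.cong +_ (ℕ.m+n∸m≡n t y)))
        lt : ∀ i → i < t ∸ 1 → t ∸ suc i < t ℕ.+ y
        lt i i< = ℕ.<-≤-trans (ℕ.∸-monoʳ-< {t} (s≤s z≤n) (ℕ.≤-trans i< (ℕ.m∸n≤m t 1))) (ℕ.m≤m+n t y)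
      ... | inj₁ h<t = begin
        ∏ hτ (λ i τi#0 → reflection i τi#0 ^ δ (t ∸ i) h) * τ (+ ∣ h - t ∣)
          ≡⟨ ≡.cong (λ m → ∏ hτ (λ i τi#0 → reflection i τi#0 ^ δ (t ∸ i) h) * τ (+ m)) (ℕ.m≤n⇒∣m-n∣≡n∸m (ℕ.<⇒≤ h<t)) ⟩
        ∏ hτ (λ i τi#0 → reflection i τi#0 ^ δ (t ∸ i) h) * τ (+ (t ∸ h))
          ≈⟨ ∏-reflection-pick hτ (AllPairs.applyUpTo⁺₁ suc (t ∸ 1) λ i<j _ → s≤s i<j) t∸h∈ (λ i → δ (t ∸ i) h)
               (≡.trans (≡.cong (λ m → δ m h) (ℕ.m∸[m∸n]≡n (ℕ.<⇒≤ h<t))) (δ-refl h))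
               (All.map (λ {i} i≤t i≢ → δ-≢ {t ∸ i} {h} λ eq → i≢ (≡.trans (≡.sym (ℕ.m∸[m∸n]≡n i≤t)) (≡.cong (t ∸_) eq))) ≤t) ⟩
        τ (ℤ.- + (t ∸ h))
          ≡⟨ ≡.cong τ (≡.trans (ℤ.m-n≡m⊖n h t) (ℤ.⊖-< h<t)) ⟨
        τ (+ h ℤ.- + t) ∎
        where
        ∈[1…] : ∀ {n} m → 0 < m → m ≤ n → m ∈ [1… n ]
        ∈[1…] (suc m) _ m<n = ∈-applyUpTo⁺ suc m<n
        t∸h∈ : t ∸ h ∈ [1… t ∸ 1 ]
        t∸h∈ = ∈[1…] (t ∸ h) (ℕ.m<n⇒0<n∸m h<t) (ℕ.∸-monoʳ-≤ t 0<h)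

      Π-reflect : ∀ {hs} → All (0 <_) hs → All (_≢ t) hs →
        ∏ hτ (λ i τi#0 → reflection i τi#0 ^ count (t ∸ i) hs) * Π (λ h → τ (+ ∣ h - t ∣)) hs ≈ Π (λ h → τ (+ h ℤ.- + t)) hs
      Π-reflect {[]}     _            _            = trans (*-identityʳ _) (∏-^0 hτ reflection (λ _ → 0) (All.universal (λ _ → ≡.refl) _))
      Π-reflect {h ∷ hs} (0<h ∷ 0<hs) (h≢t ∷ hs≢t) = trans
        (*-congʳ (∏-^+ hτ reflection (λ i → δ (t ∸ i) h) (λ i → count (t ∸ i) hs)))
        (trans (interchange _ _ _ _) (*-cong (reflect 0<h h≢t) (Π-reflect 0<hs hs≢t)))

      module _ .{{_ : NonZero t}} (κ : Core t) where

        ν μ : Partition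
        ν = value κ
        μ = quotient t ν

        open Core↦Complete (parts-decreasing ν) (core-hooks κ) using (qs; wqs; length-qs; hook-multiset)

        τ⁺ : ℕ → Carrier
        τ⁺ k = τ (+ k)

        hs : List ℕ
        hs = hooks (parts ν)

        G Gμ F⁺ F⁻ N C B : Carrier
        G  = Π τ⁺ hs
        Gμ = Π τ⁺ (hooks qs)
        F⁺ = Π τ⁺ (map (t ℕ.+_) hs)
        F⁻ = Π (λ h → τ (+ h ℤ.- + t)) hs
        N  = Π τ⁺ (map ∣_- t ∣ hs)
        C  = Π τ⁺ (contents t qs)
        B  = ∏ hτ (λ i τi#0 → reflection i τi#0 ^ β t i ν)

        -- The hooks of length t - i are those with h - t = - i, so β_i counts how often the sign
        -- correction for `i` is needed.
        B*N : B * N ≈ F⁻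
        B*N = trans
          (*-cong
            (∏-^-cong hτ reflection λ i → ≡.trans (length-filter-≟ (hook ν) (t ∸ i) (boxes ν)) (≡.cong (count (t ∸ i)) (map-hook-boxes ν)))
            (reflexive (Π-map τ⁺ ∣_- t ∣ hs)))
          (Π-reflect (hooks-positive (parts ν)) (All.map (λ { t∤h ≡.refl → t∤h ∣-refl }) (core-hooks κ)))

        F⁺*N*Gμ : F⁺ * (N * Gμ) ≈ C * (G * G)
        F⁺*N*Gμ = begin
          F⁺ * (N * Gμ)                                                     ≈⟨ Π-++₃ (map (t ℕ.+_) hs) _ (hooks qs) ⟨
          Π τ⁺ (map (t ℕ.+_) hs ++ map ∣_- t ∣ hs ++ hooks qs)              ≈⟨ Π-↭ τ⁺ hook-multiset ⟩
          Π τ⁺ (contents t qs ++ hs ++ hs)                                  ≈⟨ Π-++₃ (contents t qs) hs hs ⟩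
          C * (G * G)                                                       ∎
          where
          Π-++₃ : ∀ as bs cs → Π τ⁺ (as ++ bs ++ cs) ≈ Π τ⁺ as * (Π τ⁺ bs * Π τ⁺ cs)
          Π-++₃ as bs cs = trans (Π-++ τ⁺ as _) (*-congˡ (Π-++ τ⁺ bs cs))

        hooks-product : ∀ ρ → Π (λ □ → τ (+ hook ρ □)) (boxes ρ) ≡ Π τ⁺ (hooks (parts ρ))
        hooks-product ρ = ≡.trans (≡.sym (Π-map τ⁺ (hook ρ) (boxes ρ))) (≡.cong (Π τ⁺) (map-hook-boxes ρ))

        module _
          (hν : All (λ □ → τ (+ hook ν □) # 0#) (boxes ν))
          (hμ : All (λ □ → τ (+ hook μ □) # 0#) (boxes μ)) where

          L R : Carrier
          L = ∏ hν (λ □ τh#0 → (τ (+ hook ν □ ℤ.- + t) * τ (+ hook ν □ ℤ.+ + t)) ÷ τ (+ hook ν □) ^ 2 ⟨ ^-#0 τh#0 2 ⟩)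
          R = ∏ hμ (λ □ τh#0 → τ (+ t ℤ.+ content □) ÷ τ (+ hook μ □) ⟨ τh#0 ⟩)

          G#0 : G # 0#
          G#0 = ≡.subst (_# 0#) (hooks-product ν) (Π-#0 hν)

          hooks-μ : Π (λ □ → τ (+ hook μ □)) (boxes μ) ≡ Gμ
          hooks-μ = ≡.trans (hooks-product μ) (≡.cong (Π τ⁺) (hooks-strip wqs))

          Gμ#0 : Gμ # 0#
          Gμ#0 = ≡.subst (_# 0#) hooks-μ (Π-#0 hμ)

          L*G*G : L * (G * G) ≈ F⁻ * F⁺
          L*G*G = begin
            L * (G * G)                                              ≈⟨ *-congˡ square ⟨
            L * Π (λ □ → τ (+ hook ν □) ^ 2) (boxes ν)               ≈⟨ ∏-÷ hν _ (λ □ → τ (+ hook ν □) ^ 2) (λ τh#0 → ^-#0 τh#0 2) ⟩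
            Π (f ∘ hook ν) (boxes ν)                                 ≡⟨ Π-map f (hook ν) (boxes ν) ⟨
            Π f (map (hook ν) (boxes ν))                             ≡⟨ ≡.cong (Π f) (map-hook-boxes ν) ⟩
            Π f hs                                                   ≈⟨ Π-* (λ h → τ (+ h ℤ.- + t)) (λ h → τ (+ h ℤ.+ + t)) hs ⟩
            F⁻ * Π (λ h → τ (+ h ℤ.+ + t)) hs                        ≈⟨ *-congˡ (Π-cong (λ h → reflexive (≡.cong τ⁺ (ℕ.+-comm h t))) hs) ⟩
            F⁻ * Π (τ⁺ ∘ (t ℕ.+_)) hs                                ≡⟨ ≡.cong (F⁻ *_) (Π-map τ⁺ (t ℕ.+_) hs) ⟨
            F⁻ * F⁺                                                  ∎
            where
            f : ℕ → Carrier
            f h = τ (+ h ℤ.- + t) * τ (+ h ℤ.+ + t)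
            square : Π (λ □ → τ (+ hook ν □) ^ 2) (boxes ν) ≈ G * G
            square = trans (Π-cong (λ □ → *-congˡ (*-identityʳ _)) (boxes ν))
              (trans (Π-* _ _ (boxes ν)) (reflexive (≡.cong (λ g → g * g) (hooks-product ν))))

          R*Gμ : R * Gμ ≈ C
          R*Gμ = begin
            R * Gμ                                            ≡⟨ ≡.cong (R *_) hooks-μ ⟨
            R * Π (λ □ → τ (+ hook μ □)) (boxes μ)            ≈⟨ ∏-÷ hμ _ (λ □ → τ (+ hook μ □)) (λ τh#0 → τh#0) ⟩
            Π (λ □ → τ (+ t ℤ.+ content □)) (boxes μ)         ≡⟨ Π-map τ (λ □ → + t ℤ.+ content □) (boxes μ) ⟨
            Π τ (map (λ □ → + t ℤ.+ content □) (boxes μ))     ≡⟨ ≡.cong (Π τ) (map-contents μ len≤t) ⟩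
            Π τ (map +_ (contents t (parts μ)))               ≡⟨ Π-map τ +_ (contents t (parts μ)) ⟩
            Π τ⁺ (contents t (parts μ))                       ≡⟨ ≡.cong (Π τ⁺) (contents-strip t wqs) ⟩
            C                                                 ∎
            where
            len≤t : len μ ≤ t
            len≤t = ℕ.≤-trans (length-strip qs) (ℕ.≤-reflexive length-qs)

          -- Only values of `τ` at hook lengths of λ and μ are cancelled. The product `N` may
          -- vanish, since it contains values at h - t for h > t; it is absorbed into `F⁻` through
          -- `B*N` instead.
          product-identity : L ≈ B * R
          product-identity = *-cancelʳ-# (x#0y#0→xy#0 (x#0y#0→xy#0 G#0 G#0) Gμ#0) (begin
            L * ((G * G) * Gμ)             ≈⟨ *-assoc L _ Gμ ⟨
            L * (G * G) * Gμ               ≈⟨ *-congʳ L*G*G ⟩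
            F⁻ * F⁺ * Gμ                   ≈⟨ *-congʳ (*-congʳ B*N) ⟨
            B * N * F⁺ * Gμ                ≈⟨ solve 4 (λ b n f g → ((b ⊕ n) ⊕ f) ⊕ g ⊜ b ⊕ (f ⊕ (n ⊕ g))) refl B N F⁺ Gμ ⟩
            B * (F⁺ * (N * Gμ))            ≈⟨ *-congˡ F⁺*N*Gμ ⟩
            B * (C * (G * G))              ≈⟨ *-congˡ (*-congʳ R*Gμ) ⟨
            B * ((R * Gμ) * (G * G))       ≈⟨ solve 4 (λ b r g h → b ⊕ ((r ⊕ g) ⊕ h) ⊜ (b ⊕ r) ⊕ (h ⊕ g)) refl B R Gμ (G * G) ⟩
            (B * R) * ((G * G) * Gμ)       ∎)

theorem17 : (t : ℕ) .{{_ : NonZero t}} →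
  Σω (Core t ⤖ CompletePartition t) λ ψ →
  (κ : Core t) →
  let ν = value κ
      μ = value (Bijection.to ψ κ)
  in
  (+ size ν / 1
    ≡ (ℚ.- (+ size μ / 1)) ℚ.* _/_ (+ (size μ ℕ.+ t ℕ.+ t ℕ.^ 2)) (2 ℕ.* t ℕ.^ 2) {{m*n≢0 2 (t ℕ.^ 2) {{_}} {{m^n≢0 t 2}}}}
      ℚ.+ ∑ [1… t ] λ i → _/_ (+ (part μ i ℕ.^ 2 ℕ.+ 2 ℕ.* (t ℕ.+ 1 ∸ i) ℕ.* part μ i)) (2 ℕ.* t) {{m*n≢0 2 t}})
  ×ω
  (∀ {c ℓ₁ ℓ₂ : Level} (F : HeytingField c ℓ₁ ℓ₂) →
    let open FieldOps F in
    (τ : ℤ → Carrier)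
    (hν : All (λ □ → τ (+ hook ν □) # 0#) (boxes ν))
    (hμ : All (λ □ → τ (+ hook μ □) # 0#) (boxes μ))
    (hτ : All (λ i → τ (+ i) # 0#) [1… t ∸ 1 ]) →
    ∏ hν (λ □ τh#0 → (τ (+ hook ν □ ℤ.- + t) * τ (+ hook ν □ ℤ.+ + t)) ÷ τ (+ hook ν □) ^ 2 ⟨ ^-#0 τh#0 2 ⟩)
      ≈ ∏ hτ (λ i τi#0 → (τ (ℤ.- + i) ÷ τ (+ i) ⟨ τi#0 ⟩) ^ β t i ν)
        * ∏ hμ (λ □ τh#0 → τ (+ t ℤ.+ content □) ÷ τ (+ hook μ □) ⟨ τh#0 ⟩))
theorem17 t = ψ t ,ω λ κ → size-formula t κ ,ω λ F τ hν hμ hτ → Products.product-identity F τ hτ κ hν hμ
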